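{- Let $\mathcal{P}$ be the set of all (nonempty) integer partitions. As formal power series in $x,y$ with coefficients polynomial in $p,q$, $$\sum_{\lambda\in\mathcal{P}}p^{\mathrm{dist}(\lambda)}q^{\mathrm{even}(\lambda)}x^{\ell(\lambda)}y^{\lambda_1}=\frac{pxy}{1-x}+\frac{\left(\frac{pqx}{1-qx}+\frac{pxy(1-qx+pqx)}{(1-x)(1-qx)}\right)\left(1+\frac{px}{1-x}\right)y^2}{1-\left(1+\frac{px}{1-x}\right)\left(1+\frac{pqx}{1-qx}\right)y^2}.$$ Consequently, $$\sum_{\lambda\in\mathcal{P}}p^{\mathrm{rep}(\lambda)}q^{\mathrm{even}(\lambda)}x^{\Gamma(\lambda)}=\frac{x(1-(p-1)q(x^2+x))}{1-p(1+q)x-(1-p^2q)x^2-(1-p)(1+q)x^3-(p-1)^2qx^4},$$ and in particular $$\sum_{\lambda\in\mathcal{P}}p^{\mathrm{rep}(\lambda)}x^{\Gamma(\lambda)}=\sum_{\lambda\in\mathcal{P}}p^{\mathrm{even}(\lambda)}x^{\Gamma(\lambda)}=\frac{x}{1-(1+p)x-(1-p)x^2}.$$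
   Context: A partition is a finite nonempty weakly decreasing sequence $\lambda=(\lambda_1,\ldots,\lambda_k)$ of positive integers; $\ell(\lambda)=k$ is its number of parts and $\lambda_1$ its largest part. The perimeter is $\Gamma(\lambda)=\lambda_1+\ell(\lambda)-1$. $\mathrm{dist}(\lambda)$ is the number of distinct part values of $\lambda$; $\mathrm{rep}(\lambda)=|\{1\le i\le \ell(\lambda)-1:\lambda_i=\lambda_{i+1}\}|=\ell(\lambda)-\mathrm{dist}(\lambda)$; $\mathrm{even}(\lambda)=|\{1\le i\le\ell(\lambda):\lambda_i\text{ even}\}|$. -}

module Defs where

open import Algebra.Bundles using (CommutativeRing)
open import Algebra.Structures using (IsCommutativeRing; IsAbelianGroup)
import Algebra.Construct.Pointwise as Pointwise
import Algebra.Definitions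
import Algebra.Properties.Ring
import Algebra.Properties.Semiring.Exp
import Algebra.Properties.Semiring.Sum
open import Data.Fin.Base using (toℕ)
open import Data.Fin.Properties using (toℕ≤pred[n])
import Data.Integer.Properties as ℤ
open import Data.List.Base using (List; length; filter; deduplicate; zip; drop; map; foldr)
open import Data.List.Membership.Propositional using (_∉_)
open import Data.List.NonEmpty.Base using (List⁺; head; toList)
open import Data.List.Relation.Unary.All using (All)
open import Data.List.Relation.Unary.Linked using (Linked)
open import Data.List.Relation.Unary.Unique.Propositional using (Unique)
open import Data.Nat.Base as ℕ using (ℕ; zero; suc; _∸_; _≤_; _≥_; _>_; s≤s)
open import Data.Nat.Divisibility using (_∣?_)
import Data.Nat.Properties as ℕ
open import Data.Product.Base using (∃-syntax; _×_; _,_; proj₁; proj₂; uncurry)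
open import Level using (Level; _⊔_)
import Relation.Binary.Reasoning.Setoid
open import Relation.Nullary using (yes; no)

private
  variable
    c ℓ i e : Level

record Partition : Set where
  field
    parts      : List⁺ ℕ
    positive   : All (_> 0) (toList parts)
    decreasing : Linked _≥_ (toList parts)

  partList : List ℕ
  partList = toList parts

open Partition public

len : Partition → ℕ
len π = length (partList π)

largest : Partition → ℕ
largest π = head (parts π)

perimeter : Partition → ℕ
perimeter π = largest π ℕ.+ len π ∸ 1

dist : Partition → ℕ
dist π = length (deduplicate ℕ._≟_ (partList π))

rep : Partition → ℕ
rep π = length (filter (uncurry ℕ._≟_) (zip (partList π) (drop 1 (partList π))))

even : Partition → ℕ
even π = length (filter (2 ∣?_) (partList π))

module Quotient (R : CommutativeRing c ℓ) where
  open CommutativeRing R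
  open Algebra.Definitions _≈_ using (Invertible)

  Unit : Carrier → Set (c ⊔ ℓ)
  Unit = Invertible 1# _*_

  infixl 7 _/_⟨_⟩

  _/_⟨_⟩ : (a b : Carrier) → Unit b → Carrier
  a / b ⟨ b⁻¹ , _ ⟩ = a * b⁻¹

  Unit-* : ∀ {a b} → Unit a → Unit b → Unit (a * b)
  Unit-* {a} {b} (a′ , _ , aa′≈1) (b′ , _ , bb′≈1) =
    a′ * b′ , trans (*-comm _ _) eq , eq
    where
    open Relation.Binary.Reasoning.Setoid setoid
    eq : (a * b) * (a′ * b′) ≈ 1#
    eq = begin
      (a * b) * (a′ * b′)  ≈⟨ *-assoc a b _ ⟩
      a * (b * (a′ * b′))  ≈⟨ *-congˡ (*-congˡ (*-comm a′ b′)) ⟩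
      a * (b * (b′ * a′))  ≈⟨ *-congˡ (*-assoc b b′ a′) ⟨
      a * ((b * b′) * a′)  ≈⟨ *-congˡ (*-congʳ bb′≈1) ⟩
      a * (1# * a′)        ≈⟨ *-congˡ (*-identityˡ a′) ⟩
      a * a′               ≈⟨ aa′≈1 ⟩
      1#                   ∎

-- R[[t]]: a series is its sequence of coefficients

module PowerSeries (R : CommutativeRing c ℓ) where
  private
    module R = CommutativeRing R
    module R/ = Quotient R
  open R using (Carrier; _≈_; 0#; 1#)
  open Algebra.Properties.Semiring.Sum R.semiring using (sum; ∑-distrib-+; *-distribˡ-sum; sum-cong-≋; sum-replicate-zero)
  open Algebra.Properties.Ring R.ring using (-‿distribˡ-*; -‿distribʳ-*; -0#≈0#)
  open Relation.Binary.Reasoning.Setoid R.setoid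

  Series : Set c
  Series = ℕ → Carrier

  infix  4 _≋_
  infixl 6 _⊞_
  infixl 7 _⊠_

  _≋_ : Series → Series → Set ℓ
  f ≋ g = ∀ n → f n ≈ g n

  _⊞_ : Series → Series → Series
  (f ⊞ g) n = f n R.+ g n

  ⊟_ : Series → Series
  (⊟ f) n = R.- f n

  _⊠_ : Series → Series → Series
  (f ⊠ g) n = sum {suc n} (λ j → f (toℕ j) R.* g (n ∸ toℕ j))

  const : Carrier → Series
  const a zero    = a
  const a (suc n) = 0#

  var : Series
  var zero          = 0#
  var (suc zero)    = 1#
  var (suc (suc n)) = 0#

  𝟘 : Series
  𝟘 _ = 0#

  𝟙 : Series
  𝟙 = const 1#

  private
    shift : Series → Series
    shift f n = f (suc n)

    scale : Carrier → Series → Series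
    scale a f n = a R.* f n

  ⊠-cong-≤ : ∀ {f f′ g g′} n → (∀ m → m ≤ n → f m ≈ f′ m) → (∀ m → m ≤ n → g m ≈ g′ m) →
             (f ⊠ g) n ≈ (f′ ⊠ g′) n
  ⊠-cong-≤ n f≈ g≈ = sum-cong-≋ {n = suc n} λ j → R.*-cong (f≈ _ (toℕ≤pred[n] j)) (g≈ _ (ℕ.m∸n≤m n (toℕ j)))

  ⊠-cong : ∀ {f f′ g g′} → f ≋ f′ → g ≋ g′ → f ⊠ g ≋ f′ ⊠ g′
  ⊠-cong f≈ g≈ n = ⊠-cong-≤ n (λ m _ → f≈ m) (λ m _ → g≈ m)

  ⊠-distribʳ : ∀ h f g → (f ⊞ g) ⊠ h ≋ (f ⊠ h) ⊞ (g ⊠ h)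
  ⊠-distribʳ h f g n = R.trans
    (sum-cong-≋ {n = suc n} (λ j → R.distribʳ (h (n ∸ toℕ j)) (f (toℕ j)) (g (toℕ j))))
    (∑-distrib-+ {suc n} (λ j → f (toℕ j) R.* h (n ∸ toℕ j)) (λ j → g (toℕ j) R.* h (n ∸ toℕ j)))

  private
    scale-⊠ : ∀ a f g → scale a f ⊠ g ≋ scale a (f ⊠ g)
    scale-⊠ a f g n = R.trans
      (sum-cong-≋ {n = suc n} (λ j → R.*-assoc a (f (toℕ j)) (g (n ∸ toℕ j))))
      (R.sym (*-distribˡ-sum {suc n} a (λ j → f (toℕ j) R.* g (n ∸ toℕ j))))

    -- (f ⊠ g) (suc n) is by definition f 0 * g (suc n) + (shift f ⊠ g) n;
    -- this splits off the last summand instead.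
    ⊠-last : ∀ f g n → (f ⊠ g) (suc n) ≈ (f ⊠ shift g) n R.+ f (suc n) R.* g 0
    ⊠-last f g zero = begin
      f 0 R.* g 1 R.+ (f 1 R.* g 0 R.+ 0#)  ≈⟨ R.+-congˡ (R.+-identityʳ _) ⟩
      f 0 R.* g 1 R.+ f 1 R.* g 0           ≈⟨ R.+-congʳ (R.+-identityʳ _) ⟨
      (f 0 R.* g 1 R.+ 0#) R.+ f 1 R.* g 0  ∎
    ⊠-last f g (suc n) = R.trans (R.+-congˡ (⊠-last (shift f) g n)) (R.sym (R.+-assoc _ _ _))

  ⊠-comm : ∀ f g → f ⊠ g ≋ g ⊠ f
  ⊠-comm f g zero    = R.+-congʳ (R.*-comm _ _)
  ⊠-comm f g (suc n) = begin
    f 0 R.* g (suc n) R.+ (shift f ⊠ g) n  ≈⟨ R.+-cong (R.*-comm _ _) (⊠-comm (shift f) g n) ⟩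
    g (suc n) R.* f 0 R.+ (g ⊠ shift f) n  ≈⟨ R.+-comm _ _ ⟩
    (g ⊠ shift f) n R.+ g (suc n) R.* f 0  ≈⟨ ⊠-last g f n ⟨
    (g ⊠ f) (suc n)                        ∎

  ⊠-assoc : ∀ f g h → (f ⊠ g) ⊠ h ≋ f ⊠ (g ⊠ h)
  ⊠-assoc f g h zero = R.+-congʳ (begin
    (f 0 R.* g 0 R.+ 0#) R.* h 0  ≈⟨ R.*-congʳ (R.+-identityʳ _) ⟩
    (f 0 R.* g 0) R.* h 0         ≈⟨ R.*-assoc _ _ _ ⟩
    f 0 R.* (g 0 R.* h 0)         ≈⟨ R.*-congˡ (R.+-identityʳ _) ⟨
    f 0 R.* (g 0 R.* h 0 R.+ 0#)  ∎)
  ⊠-assoc f g h (suc n) = begin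
    (f 0 R.* g 0 R.+ 0#) R.* h (suc n) R.+ ((scale (f 0) (shift g) ⊞ (shift f ⊠ g)) ⊠ h) n
      ≈⟨ R.+-cong (R.trans (R.*-congʳ (R.+-identityʳ _)) (R.*-assoc _ _ _))
                  (⊠-distribʳ h (scale (f 0) (shift g)) (shift f ⊠ g) n) ⟩
    f 0 R.* (g 0 R.* h (suc n)) R.+ ((scale (f 0) (shift g) ⊠ h) n R.+ ((shift f ⊠ g) ⊠ h) n)
      ≈⟨ R.+-congˡ (R.+-cong (scale-⊠ (f 0) (shift g) h n) (⊠-assoc (shift f) g h n)) ⟩
    f 0 R.* (g 0 R.* h (suc n)) R.+ (f 0 R.* (shift g ⊠ h) n R.+ (shift f ⊠ (g ⊠ h)) n)
      ≈⟨ R.+-assoc _ _ _ ⟨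
    (f 0 R.* (g 0 R.* h (suc n)) R.+ f 0 R.* (shift g ⊠ h) n) R.+ (shift f ⊠ (g ⊠ h)) n
      ≈⟨ R.+-congʳ (R.distribˡ _ _ _) ⟨
    f 0 R.* (g ⊠ h) (suc n) R.+ (shift f ⊠ (g ⊠ h)) n ∎

  ⊠-zeroˡ : ∀ f → 𝟘 ⊠ f ≋ 𝟘
  ⊠-zeroˡ f n = R.trans (sum-cong-≋ {n = suc n} (λ j → R.zeroˡ (f (n ∸ toℕ j)))) (sum-replicate-zero (suc n))

  ⊠-identityˡ : ∀ f → 𝟙 ⊠ f ≋ f
  ⊠-identityˡ f zero    = R.trans (R.+-identityʳ _) (R.*-identityˡ _)
  ⊠-identityˡ f (suc n) = R.trans (R.+-cong (R.*-identityˡ _) (⊠-zeroˡ f n)) (R.+-identityʳ _)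

  ⊞-isAbelianGroup : IsAbelianGroup _≋_ _⊞_ 𝟘 ⊟_
  ⊞-isAbelianGroup = Pointwise.isAbelianGroup ℕ R.+-isAbelianGroup

  isCommutativeRing : IsCommutativeRing _≋_ _⊞_ _⊠_ ⊟_ 𝟘 𝟙
  isCommutativeRing = record
    { isRing = record
      { +-isAbelianGroup = ⊞-isAbelianGroup
      ; *-cong           = ⊠-cong
      ; *-assoc          = ⊠-assoc
      ; *-identity       = ⊠-identityˡ , λ f n → R.trans (⊠-comm f 𝟙 n) (⊠-identityˡ f n)
      ; distrib          = (λ f g h n → R.trans (⊠-comm f (g ⊞ h) n)
                                       (R.trans (⊠-distribʳ f g h n)
                                                (R.+-cong (⊠-comm g f n) (⊠-comm h f n))))
                         , ⊠-distribʳ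
      }
    ; *-comm = ⊠-comm
    }

  ring : CommutativeRing c ℓ
  ring = record { isCommutativeRing = isCommutativeRing }

  open Quotient ring using (Unit)

  private
    module Reciprocal (f : Series) (u : Carrier) (f₀u≈1 : f 0 R.* u ≈ 1#) where

      -- The first n + 1 coefficients of approx n are those of the reciprocal.
      approx : ℕ → Series
      approx n       zero    = u
      approx zero    (suc m) = 0#
      approx (suc n) (suc m) = R.- (u R.* (shift f ⊠ approx n) m)

      recip : Series
      recip n = approx n n

      agree : ∀ n n′ m → m ≤ n → m ≤ n′ → approx n m ≈ approx n′ m
      agree n       n′       zero    _         _          = R.refl
      agree (suc n) (suc n′) (suc m) (s≤s m≤n) (s≤s m≤n′) = R.-‿cong (R.*-congˡ
        (⊠-cong-≤ {f = shift f} m (λ _ _ → R.refl)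
          (λ j j≤m → agree n n′ j (ℕ.≤-trans j≤m m≤n) (ℕ.≤-trans j≤m m≤n′))))

      correct : f ⊠ recip ≋ 𝟙
      correct zero    = R.trans (R.+-identityʳ _) f₀u≈1
      correct (suc n) = begin
        f 0 R.* (R.- (u R.* (shift f ⊠ approx n) n)) R.+ s
          ≈⟨ R.+-congʳ (R.*-congˡ (R.-‿cong (R.*-congˡ (⊠-cong-≤ {f = shift f} n (λ _ _ → R.refl) (λ j j≤n → agree n j j j≤n ℕ.≤-refl))))) ⟩
        f 0 R.* (R.- (u R.* s)) R.+ s
          ≈⟨ R.+-congʳ (R.*-congˡ (-‿distribˡ-* u s)) ⟩
        f 0 R.* ((R.- u) R.* s) R.+ s
          ≈⟨ R.+-congʳ (R.*-assoc _ _ _) ⟨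
        (f 0 R.* (R.- u)) R.* s R.+ s
          ≈⟨ R.+-congʳ (R.*-congʳ f₀u′) ⟩
        (R.- 1#) R.* s R.+ s
          ≈⟨ R.+-congʳ (R.trans (R.sym (-‿distribˡ-* 1# s)) (R.-‿cong (R.*-identityˡ s))) ⟩
        R.- s R.+ s
          ≈⟨ R.-‿inverseˡ s ⟩
        0# ∎
        where
        s = (shift f ⊠ recip) n
        f₀u′ : f 0 R.* (R.- u) ≈ R.- 1#
        f₀u′ = R.trans (R.sym (-‿distribʳ-* (f 0) u)) (R.-‿cong f₀u≈1)

  unit : ∀ f → R/.Unit (f 0) → Unit f
  unit f (u , _ , f₀u≈1) = recip , (λ n → R.trans (⊠-comm recip f n) (correct n)) , correct
    where open Reciprocal f u f₀u≈1

  unit₁ : ∀ f → f 0 ≈ 1# → Unit f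
  unit₁ f f₀≈1 = unit f (1# , R.trans (R.*-identityˡ _) f₀≈1 , R.trans (R.*-identityʳ _) f₀≈1)

  ⊠-vanish : ∀ f g → g 0 ≈ 0# → (f ⊠ g) 0 ≈ 0#
  ⊠-vanish f g g₀≈0 = R.trans (R.+-identityʳ _) (R.trans (R.*-congˡ g₀≈0) (R.zeroʳ _))

  -‿vanish : ∀ {a b z} → a ≈ b → z ≈ 0# → a R.- z ≈ b
  -‿vanish a≈b z≈0 = R.trans (R.+-cong a≈b (R.trans (R.-‿cong z≈0) -0#≈0#)) (R.+-identityʳ _)

-- The polynomial ring R[t]: finitely supported sequences of coefficients,
-- a subring of R[[t]]

module Polynomials (R : CommutativeRing c ℓ) where
  private
    module R = CommutativeRing R
  open R using (Carrier; _≈_; 0#; 1#)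
  open Algebra.Properties.Semiring.Sum R.semiring using (sum-cong-≋; sum-replicate-zero)
  open Algebra.Properties.Ring R.ring using (-0#≈0#)
  private
    module S where
      open PowerSeries R public
      open CommutativeRing ring public using (*-identity; distrib)

  record Polynomial : Set (c ⊔ ℓ) where
    field
      coeff  : ℕ → Carrier
      bound  : ℕ
      vanish : ∀ n → bound ≤ n → coeff n ≈ 0#

  open Polynomial public

  infix 4 _≈ₚ_

  _≈ₚ_ : Polynomial → Polynomial → Set ℓ
  f ≈ₚ g = coeff f S.≋ coeff g

  const : Carrier → Polynomial
  const a = record { coeff = S.const a ; bound = 1 ; vanish = λ where (suc n) _ → R.refl }

  var : Polynomial
  var = record { coeff = S.var ; bound = 2 ; vanish = λ where (suc (suc n)) _ → R.refl ; (suc zero) (s≤s ()) }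

  0ₚ : Polynomial
  0ₚ = record { coeff = S.𝟘 ; bound = 0 ; vanish = λ _ _ → R.refl }

  1ₚ : Polynomial
  1ₚ = const 1#

  _+ₚ_ : Polynomial → Polynomial → Polynomial
  f +ₚ g = record
    { coeff  = coeff f S.⊞ coeff g
    ; bound  = bound f ℕ.⊔ bound g
    ; vanish = λ n le → R.trans
        (R.+-cong (vanish f n (ℕ.m⊔n≤o⇒m≤o (bound f) (bound g) le))
                  (vanish g n (ℕ.m⊔n≤o⇒n≤o (bound f) (bound g) le)))
        (R.+-identityʳ _)
    }

  -ₚ_ : Polynomial → Polynomial
  -ₚ f = record
    { coeff  = S.⊟ coeff f
    ; bound  = bound f
    ; vanish = λ n le → R.trans (R.-‿cong (vanish f n le)) -0#≈0#
    }

  _*ₚ_ : Polynomial → Polynomial → Polynomial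
  f *ₚ g = record
    { coeff  = coeff f S.⊠ coeff g
    ; bound  = bound f ℕ.+ bound g
    ; vanish = λ n le → R.trans (sum-cong-≋ {n = suc n} (λ j → term n le (toℕ j))) (sum-replicate-zero (suc n))
    }
    where
    term : ∀ n → bound f ℕ.+ bound g ≤ n → ∀ j → coeff f j R.* coeff g (n ∸ j) ≈ 0#
    term n le j with bound f ℕ.≤? j
    ... | yes b≤j = R.trans (R.*-congʳ (vanish f j b≤j)) (R.zeroˡ _)
    ... | no  b≰j = R.trans (R.*-congˡ (vanish g (n ∸ j) g≤)) (R.zeroʳ _)
      where
      g≤ : bound g ≤ n ∸ j
      g≤ = ℕ.m+n≤o⇒m≤o∸n (bound g) (ℕ.≤-trans (ℕ.+-monoʳ-≤ (bound g) (ℕ.<⇒≤ (ℕ.≰⇒> b≰j)))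
             (ℕ.≤-trans (ℕ.≤-reflexive (ℕ.+-comm (bound g) (bound f))) le))

  isCommutativeRing : IsCommutativeRing _≈ₚ_ _+ₚ_ _*ₚ_ -ₚ_ 0ₚ 1ₚ
  isCommutativeRing = record
    { isRing = record
      { +-isAbelianGroup = record
        { isGroup = record
          { isMonoid = record
            { isSemigroup = record
              { isMagma = record
                { isEquivalence = record
                  { refl  = λ _ → R.refl
                  ; sym   = λ p n → R.sym (p n)
                  ; trans = λ p q n → R.trans (p n) (q n)
                  }
                ; ∙-cong = λ p q n → R.+-cong (p n) (q n)
                }
              ; assoc = λ _ _ _ _ → R.+-assoc _ _ _
              }
            ; identity = (λ _ _ → R.+-identityˡ _) , (λ _ _ → R.+-identityʳ _)
            }
          ; inverse = (λ _ _ → R.-‿inverseˡ _) , (λ _ _ → R.-‿inverseʳ _)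
          ; ⁻¹-cong = λ p n → R.-‿cong (p n)
          }
        ; comm = λ _ _ _ → R.+-comm _ _
        }
      ; *-cong     = S.⊠-cong
      ; *-assoc    = λ f g h → S.⊠-assoc (coeff f) (coeff g) (coeff h)
      ; *-identity = (λ f → proj₁ S.*-identity (coeff f)) , (λ f → proj₂ S.*-identity (coeff f))
      ; distrib    = (λ f g h → proj₁ S.distrib (coeff f) (coeff g) (coeff h))
                   , (λ f g h → proj₂ S.distrib (coeff f) (coeff g) (coeff h))
      }
    ; *-comm = λ f g → S.⊠-comm (coeff f) (coeff g)
    }

  ring : CommutativeRing (c ⊔ ℓ) ℓ
  ring = record { isCommutativeRing = isCommutativeRing }

-- Infinite sums of formal power series, given by their coefficients at
-- the exponents in E: at each exponent all members of the family outside
-- some finite set have coefficient 0, and the coefficients of the members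
-- of that set add up to the coefficient of s.  The finite set is given as
-- a duplicate-free list.

module Summation (R : CommutativeRing c ℓ) where
  open CommutativeRing R

  listSum : List Carrier → Carrier
  listSum = foldr _+_ 0#

  HasCoefficientwiseSum : {I : Set i} {E : Set e} → (I → E → Carrier) → (E → Carrier) → Set (i ⊔ e ⊔ ℓ)
  HasCoefficientwiseSum {I = I} {E = E} f s = (n : E) →
    ∃[ js ] Unique js
          × ((j : I) → j ∉ js → f j n ≈ 0#)
          × s n ≈ listSum (map (λ j → f j n) js)

-- Generating functions in R[[x]], with p and q elements of R

module Univariate (R : CommutativeRing c ℓ) where
  open PowerSeries R public using (ring; const) renaming (var to x)
  open PowerSeries R using (unit₁; ⊠-vanish; -‿vanish)
  open CommutativeRing ring public using (Carrier; _≈_; _+_; _*_; _-_; 0#; 1#)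
  open Algebra.Properties.Semiring.Exp (CommutativeRing.semiring ring) public using (_^_)
  open Quotient ring public using (Unit; _/_⟨_⟩)
  private
    module R = CommutativeRing R

  HasSum : {I : Set i} → (I → Carrier) → Carrier → Set (i ⊔ ℓ)
  HasSum f s = Summation.HasCoefficientwiseSum R f s

  private
    vanish : ∀ a n → (a * x ^ suc n) 0 R.≈ R.0#
    vanish a n = ⊠-vanish a (x ^ suc n) (R.trans (R.+-identityʳ _) (R.zeroˡ _))

  repEvenUnit : ∀ p q → Unit (1# - p * (1# + q) * x - (1# - p ^ 2 * q) * x ^ 2
                                 - (1# - p) * (1# + q) * x ^ 3 - (p - 1#) ^ 2 * q * x ^ 4)
  repEvenUnit p q = unit₁ _
    (-‿vanish (-‿vanish (-‿vanish (-‿vanish R.refl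
      (⊠-vanish (p * (1# + q)) x R.refl))
      (vanish (1# - p ^ 2 * q) 1))
      (vanish ((1# - p) * (1# + q)) 2))
      (vanish ((p - 1#) ^ 2 * q) 3))

  perimeterUnit : ∀ p → Unit (1# - (1# + p) * x - (1# - p) * x ^ 2)
  perimeterUnit p = unit₁ _
    (-‿vanish (-‿vanish R.refl
      (⊠-vanish (1# + p) x R.refl))
      (vanish (1# - p) 1))

  module _ (p₀ q₀ : R.Carrier) where
    private
      p q : Carrier
      p = const p₀
      q = const q₀

    repEvenTerm : Partition → Carrier
    repEvenTerm π = p ^ rep π * q ^ even π * x ^ perimeter π

    repEvenSeries : Carrier
    repEvenSeries =
      x * (1# - (p - 1#) * q * (x ^ 2 + x))
      / (1# - p * (1# + q) * x - (1# - p ^ 2 * q) * x ^ 2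
            - (1# - p) * (1# + q) * x ^ 3 - (p - 1#) ^ 2 * q * x ^ 4) ⟨ repEvenUnit p q ⟩

  module _ (p₀ : R.Carrier) where
    private
      p : Carrier
      p = const p₀

    repTerm : Partition → Carrier
    repTerm π = p ^ rep π * x ^ perimeter π

    evenTerm : Partition → Carrier
    evenTerm π = p ^ even π * x ^ perimeter π

    perimeterSeries : Carrier
    perimeterSeries = x / (1# - (1# + p) * x - (1# - p) * x ^ 2) ⟨ perimeterUnit p ⟩

-- Generating functions in R[[x,y]], with p and q elements of R.  R[[x,y]]
-- is taken as R[[x]][[y]]: the coefficient of xᵐ yⁿ in f is f n m

module Bivariate (R : CommutativeRing c ℓ) where
  private
    module R = CommutativeRing R
    module X = PowerSeries R
    module Y = PowerSeries X.ring
  open Y public using (ring) renaming (var to y)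
  open CommutativeRing ring public using (Carrier; _≈_; _+_; _*_; _-_; 0#; 1#)
  open Algebra.Properties.Semiring.Exp (CommutativeRing.semiring ring) public using (_^_)
  open Quotient ring public using (Unit; Unit-*; _/_⟨_⟩)

  const : R.Carrier → Carrier
  const a = Y.const (X.const a)

  x : Carrier
  x = Y.const X.var

  HasSum : {I : Set i} → (I → Carrier) → Carrier → Set (i ⊔ ℓ)
  HasSum f s = Summation.HasCoefficientwiseSum R {E = ℕ × ℕ} (λ j (m , n) → f j n m) (λ (m , n) → s n m)

  private
    vanish : ∀ f g → g 0 0 R.≈ R.0# → (f * g) 0 0 R.≈ R.0#
    vanish f g g₀₀≈0 = R.trans (R.+-identityʳ _) (X.⊠-vanish (f 0) (g 0) g₀₀≈0)

    1-unit : ∀ f → f 0 0 R.≈ R.0# → Unit (1# - f)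
    1-unit f f₀₀≈0 = Y.unit (1# - f) (X.unit₁ ((1# - f) 0) (X.-‿vanish R.refl f₀₀≈0))

  1-x-unit : Unit (1# - x)
  1-x-unit = 1-unit x R.refl

  1-ax-unit : ∀ a → Unit (1# - a * x)
  1-ax-unit a = 1-unit (a * x) (vanish a x R.refl)

  1-fy²-unit : ∀ f → Unit (1# - f * y ^ 2)
  1-fy²-unit f = 1-unit (f * y ^ 2) (vanish f (y ^ 2) (vanish y (y ^ 1)
    (R.trans (R.+-identityʳ _) (R.trans (R.+-identityʳ _) (R.zeroˡ _)))))

  module _ (p₀ q₀ : R.Carrier) where
    private
      p q : Carrier
      p = const p₀
      q = const q₀

    distEvenTerm : Partition → Carrier
    distEvenTerm π = p ^ dist π * q ^ even π * x ^ len π * y ^ largest π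

    distEvenSeries : Carrier
    distEvenSeries =
      p * x * y / (1# - x) ⟨ 1-x-unit ⟩
      + ( p * q * x / (1# - q * x) ⟨ 1-ax-unit q ⟩
        + p * x * y * (1# - q * x + p * q * x)
          / ((1# - x) * (1# - q * x)) ⟨ Unit-* 1-x-unit (1-ax-unit q) ⟩ )
        * (1# + p * x / (1# - x) ⟨ 1-x-unit ⟩)
        * y ^ 2
        / (1# - (1# + p * x / (1# - x) ⟨ 1-x-unit ⟩)
                * (1# + p * q * x / (1# - q * x) ⟨ 1-ax-unit q ⟩)
                * y ^ 2)
          ⟨ 1-fy²-unit ((1# + p * x / (1# - x) ⟨ 1-x-unit ⟩)
                        * (1# + p * q * x / (1# - q * x) ⟨ 1-ax-unit q ⟩)) ⟩

module ℤ[p] where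
  ring : CommutativeRing _ _
  ring = Polynomials.ring ℤ.+-*-commutativeRing

  p : CommutativeRing.Carrier ring
  p = Polynomials.var ℤ.+-*-commutativeRing

module ℤ[p,q] where
  ring : CommutativeRing _ _
  ring = Polynomials.ring ℤ[p].ring

  p q : CommutativeRing.Carrier ring
  p = Polynomials.const ℤ[p].ring ℤ[p].p
  q = Polynomials.var ℤ[p].ring

{-# OPTIONS --safe #-}
module Submission where

open import Algebra.Bundles using (CommutativeRing)
import Algebra.Properties.AbelianGroup
import Algebra.Properties.CommutativeSemigroup
import Algebra.Properties.Ring
import Algebra.Properties.Semiring.Exp
import Algebra.Properties.Semiring.Mult.TCOptimised
import Algebra.Solver.Ring
open import Algebra.Solver.Ring.AlmostCommutativeRing using (_-Raw-AlmostCommutative⟶_; fromCommutativeRing)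
open import Data.Bool.Base using (true; false)
open import Data.Integer.Base as ℤ using (ℤ; +_; -[1+_]; _⊖_)
import Data.Integer.Properties as ℤ
open import Data.List.Base using (List; []; _∷_; _++_; map; length; filter; deduplicate; zip; drop)
open import Data.List.Membership.Propositional using (_∈_; _∉_)
open import Data.List.Membership.Propositional.Properties using (∈-++⁺ˡ; ∈-++⁺ʳ; ∈-++⁻; ∈-map⁺; ∈-map⁻)
import Data.List.NonEmpty.Base as List⁺
open import Data.List.Properties using (filter-all; filter-accept; filter-reject; filter-idem; ∷-injectiveʳ; map-++; map-∘)
open import Data.List.Relation.Unary.All as All using (All; []; _∷_)
import Data.List.Relation.Unary.All.Properties as All
open import Data.List.Relation.Unary.AllPairs using ([]; _∷_)
open import Data.List.Relation.Unary.Any using (here; there)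
open import Data.List.Relation.Unary.Linked as Linked using (Linked; [-]; _∷_)
open import Data.List.Relation.Unary.Linked.Properties using (Linked⇒All)
open import Data.List.Relation.Unary.Unique.Propositional using (Unique)
import Data.List.Relation.Unary.Unique.Propositional.Properties as Unique
open import Data.Maybe.Base using (Maybe; just; nothing)
open import Data.Nat.Base as ℕ using (ℕ; zero; suc; _≤_; _≥_; _>_; z≤n; s≤s)
open import Data.Nat.Divisibility using (_∣?_)
import Data.Nat.Properties as ℕ
open import Data.Product.Base using (∃-syntax; _×_; _,_; proj₁; proj₂; uncurry)
open import Data.Sum.Base using (inj₁; inj₂)
open import Function.Base using (_∘_; flip)
open import Level using (Level)
open import Relation.Binary.PropositionalEquality as ≡ using (_≡_; _≢_)
import Relation.Binary.Reasoning.Setoid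
open import Relation.Nullary using (¬_; ¬?; yes; no; does; contradiction)
open import Defs

-- Let T (resp. W) enumerate the partitions, the empty one included (resp. excluded),
-- with y marking a bound n on the parts (resp. the largest part n) and x the length,
-- each partition having weight p^dist r^rep q^even.  Splitting T = T₀ + T₁ and
-- W = W₀ + W₁ by the parity of n, removal of the largest part gives the linear system
--   T₀ = 1 + y T₁ + W₀,  W₀ = q (p x y T₁ + r x W₀),
--   T₁ = y T₀ + W₁,      W₁ = p x y T₀ + r x W₁.
-- With r = 1 its solution is the bivariate formula.  The perimeter generating
-- functions come from y = x and p = 1, where W = x Σ r^rep q^even x^Γ.

-- The two marks `p` and `r` are kept apart for a reason. Deducing the perimeter formula from the
-- bivariate one would use rep = len - dist, that is, the substitution of 1/p for p and of p x for
-- x, but `p` need not be invertible. With a separate `r`, one linear system specialises to both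
-- situations.
--
-- The system closes because of two choices. Once the largest part n is removed, the rest either has
-- all parts at most n - 1, which is what the bounded series T counts (factor p x y), or again has
-- largest part n (factor r x). And the evenness factor of n depends only on its parity, so on each
-- parity half it is a scalar, `q` or 1, while multiplication by y exchanges the halves.
--
-- The coefficient ring is arbitrary, so nothing may be divided out except proven units and the
-- variable x. Each perimeter formula is therefore checked in the form W times denominator, as an
-- explicit combination of the four equations.

private
  variable
    c ℓ : Level

-- A ring solver with integer coefficients

module IntegerCoefficients (R : CommutativeRing c ℓ) where
  open CommutativeRing R
  open Algebra.Properties.Ring ring using (-‿distribˡ-*; -‿distribʳ-*; -0#≈0#; -‿involutive)
  open Algebra.Properties.AbelianGroup +-abelianGroup using (⁻¹-∙-comm)
  open Algebra.Properties.Semiring.Mult.TCOptimised semiring using (1+×; ×-homo-+; ×1-homo-*) renaming (_×_ to _×ₙ_)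
  open Relation.Binary.Reasoning.Setoid setoid

  -- Equality in `R` is not decidable in general, whereas normalisation has to recognise cancelling
  -- coefficients. Over the integers it can.
  fromℤ : ℤ → Carrier
  fromℤ (+ n)    = n ×ₙ 1#
  fromℤ -[1+ n ] = - (suc n ×ₙ 1#)

  private
    cancel : ∀ a b d → (a + b) - (a + d) ≈ b - d
    cancel a b d = begin
      (a + b) - (a + d)      ≈⟨ +-cong (+-comm a b) (sym (⁻¹-∙-comm a d)) ⟩
      (b + a) + (- a - d)    ≈⟨ +-assoc b a _ ⟩
      b + (a + (- a - d))    ≈⟨ +-congˡ (+-assoc a (- a) (- d)) ⟨
      b + ((a - a) - d)      ≈⟨ +-congˡ (+-congʳ (-‿inverseʳ a)) ⟩
      b + (0# - d)           ≈⟨ +-congˡ (+-identityˡ _) ⟩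
      b - d                  ∎

  fromℤ-⊖ : ∀ m n → fromℤ (m ⊖ n) ≈ m ×ₙ 1# - n ×ₙ 1#
  fromℤ-⊖ m       zero    = sym (trans (+-congˡ -0#≈0#) (+-identityʳ _))
  fromℤ-⊖ zero    (suc n) = sym (+-identityˡ _)
  fromℤ-⊖ (suc m) (suc n) = begin
    fromℤ (suc m ⊖ suc n)            ≡⟨ ≡.cong fromℤ (ℤ.[1+m]⊖[1+n]≡m⊖n m n) ⟩
    fromℤ (m ⊖ n)                    ≈⟨ fromℤ-⊖ m n ⟩
    m ×ₙ 1# - n ×ₙ 1#                ≈⟨ cancel 1# _ _ ⟨
    (1# + m ×ₙ 1#) - (1# + n ×ₙ 1#)  ≈⟨ +-cong (1+× m 1#) (-‿cong (1+× n 1#)) ⟨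
    suc m ×ₙ 1# - suc n ×ₙ 1#        ∎

  fromℤ-+ : ∀ i j → fromℤ (i ℤ.+ j) ≈ fromℤ i + fromℤ j
  fromℤ-+ (+ m)    (+ n)    = ×-homo-+ 1# m n
  fromℤ-+ (+ m)    -[1+ n ] = fromℤ-⊖ m (suc n)
  fromℤ-+ -[1+ m ] (+ n)    = trans (fromℤ-⊖ n (suc m)) (+-comm _ _)
  fromℤ-+ -[1+ m ] -[1+ n ] = begin
    - (suc (suc (m ℕ.+ n)) ×ₙ 1#)  ≡⟨ ≡.cong (λ k → - (suc k ×ₙ 1#)) (ℕ.+-suc m n) ⟨
    - ((suc m ℕ.+ suc n) ×ₙ 1#)    ≈⟨ -‿cong (×-homo-+ 1# (suc m) (suc n)) ⟩
    - (suc m ×ₙ 1# + suc n ×ₙ 1#)  ≈⟨ ⁻¹-∙-comm _ _ ⟨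
    - (suc m ×ₙ 1#) - suc n ×ₙ 1#  ∎

  fromℤ-neg : ∀ i → fromℤ (ℤ.- i) ≈ - fromℤ i
  fromℤ-neg (+ zero)  = sym -0#≈0#
  fromℤ-neg (+ suc n) = refl
  fromℤ-neg -[1+ n ]  = sym (-‿involutive _)

  private
    fromℤ-pos-* : ∀ m n → fromℤ (+ m ℤ.* + n) ≈ m ×ₙ 1# * n ×ₙ 1#
    fromℤ-pos-* m n = trans (reflexive (≡.cong fromℤ (≡.sym (ℤ.pos-* m n)))) (×1-homo-* m n)

    fromℤ-*-+ : ∀ i n → fromℤ (i ℤ.* + n) ≈ fromℤ i * n ×ₙ 1#
    fromℤ-*-+ (+ m)    n = fromℤ-pos-* m n
    fromℤ-*-+ -[1+ m ] n = begin
      fromℤ (-[1+ m ] ℤ.* + n)       ≡⟨ ≡.cong fromℤ (ℤ.neg-distribˡ-* (+ suc m) (+ n)) ⟨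
      fromℤ (ℤ.- (+ suc m ℤ.* + n))  ≈⟨ fromℤ-neg (+ suc m ℤ.* + n) ⟩
      - fromℤ (+ suc m ℤ.* + n)      ≈⟨ -‿cong (fromℤ-pos-* (suc m) n) ⟩
      - (suc m ×ₙ 1# * n ×ₙ 1#)      ≈⟨ -‿distribˡ-* _ _ ⟩
      - (suc m ×ₙ 1#) * n ×ₙ 1#      ∎

  fromℤ-* : ∀ i j → fromℤ (i ℤ.* j) ≈ fromℤ i * fromℤ j
  fromℤ-* i (+ n)    = fromℤ-*-+ i n
  fromℤ-* i -[1+ n ] = begin
    fromℤ (i ℤ.* -[1+ n ])       ≡⟨ ≡.cong fromℤ (ℤ.neg-distribʳ-* i (+ suc n)) ⟨
    fromℤ (ℤ.- (i ℤ.* + suc n))  ≈⟨ fromℤ-neg (i ℤ.* + suc n) ⟩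
    - fromℤ (i ℤ.* + suc n)      ≈⟨ -‿cong (fromℤ-*-+ i (suc n)) ⟩
    - (fromℤ i * suc n ×ₙ 1#)    ≈⟨ -‿distribʳ-* _ _ ⟩
    fromℤ i * - (suc n ×ₙ 1#)    ∎

  private
    homomorphism : ℤ.+-*-rawRing -Raw-AlmostCommutative⟶ fromCommutativeRing R
    homomorphism = record
      { ⟦_⟧    = fromℤ
      ; +-homo = fromℤ-+
      ; *-homo = fromℤ-*
      ; -‿homo = fromℤ-neg
      ; 0-homo = refl
      ; 1-homo = refl
      }

    dec : ∀ i j → Maybe (fromℤ i ≈ fromℤ j)
    dec i j with i ℤ.≟ j
    ... | yes i≡j = just (reflexive (≡.cong fromℤ i≡j))
    ... | no  _   = nothing

  module Solver = Algebra.Solver.Ring ℤ.+-*-rawRing (fromCommutativeRing R) homomorphism dec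

-- Solving the linear system

module Algebraic (S : CommutativeRing c ℓ) where
  open CommutativeRing S
  open Algebra.Properties.Semiring.Exp semiring using (_^_)
  open Algebra.Properties.AbelianGroup +-abelianGroup using (x≈y⇒x∙y⁻¹≈ε)
  open Quotient S
  open IntegerCoefficients S using (module Solver)
  open Solver using (solve; _:=_; _:+_; _:*_; _:-_; :-_; _:^_; con)
  open Relation.Binary.Reasoning.Setoid setoid

  *-≈⇒≈-/ : ∀ {w n d} (u : Unit d) → w * d ≈ n → w ≈ n / d ⟨ u ⟩
  *-≈⇒≈-/ {w} {n} {d} (d⁻¹ , _ , dd⁻¹≈1) wd≈n = begin
    w               ≈⟨ *-identityʳ w ⟨
    w * 1#          ≈⟨ *-congˡ dd⁻¹≈1 ⟨
    w * (d * d⁻¹)   ≈⟨ *-assoc w d d⁻¹ ⟨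
    w * d * d⁻¹     ≈⟨ *-congʳ wd≈n ⟩
    n * d⁻¹         ∎

  -- The solver proves only unconditional polynomial identities. A hypothesis `l ≈ r` enters such an
  -- identity as an explicit multiple of `l - r`, which is then removed here.
  discharge : ∀ {a b l r} k → a ≈ b + k * (l - r) → l ≈ r → a ≈ b
  discharge {a} {b} {l} {r} k a≈ l≈r = begin
    a                 ≈⟨ a≈ ⟩
    b + k * (l - r)   ≈⟨ +-congˡ (*-congˡ (x≈y⇒x∙y⁻¹≈ε l≈r)) ⟩
    b + k * 0#        ≈⟨ +-congˡ (zeroʳ k) ⟩
    b + 0#            ≈⟨ +-identityʳ b ⟩
    b                 ∎

  -- Products are nested to the right so that every factor acts as a left multiplication by a
  -- constant, `x` or `y`. The coefficient lemmas and the substitution y = x treat these one at a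
  -- time.
  record System (p r q x y t₀ t₁ w₀ w₁ : Carrier) : Set ℓ where
    field
      eq-t₀ : t₀ ≈ 1# + (y * t₁ + w₀)
      eq-t₁ : t₁ ≈ y * t₀ + w₁
      eq-w₀ : w₀ ≈ q * (p * (x * (y * t₁)) + r * (x * w₀))
      eq-w₁ : w₁ ≈ p * (x * (y * t₀)) + r * (x * w₁)

  module _ {p r q x y t₀ t₁ w₀ w₁} (sys : System p r q x y t₀ t₁ w₀ w₁) where
    open System sys

    -- In the identities below the multipliers come from Cramer's rule for the system.
    discharge-system : ∀ {a b} k₀ k₁ l₀ l₁ →
      a ≈ b + k₀ * (t₀ - (1# + (y * t₁ + w₀))) + k₁ * (t₁ - (y * t₀ + w₁))
            + l₀ * (w₀ - q * (p * (x * (y * t₁)) + r * (x * w₀)))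
            + l₁ * (w₁ - (p * (x * (y * t₀)) + r * (x * w₁))) →
      a ≈ b
    discharge-system k₀ k₁ l₀ l₁ a≈ =
      discharge k₀ (discharge k₁ (discharge l₀ (discharge l₁ a≈ eq-w₁) eq-w₀) eq-t₁) eq-t₀

  -- The mark of repetitions is called `p` here and stands in the `r` slot. The denominator is the
  -- determinant `a * b - x ^ 2 * (a + x) * (b + q * x)` of the system. The extra `x` on the right
  -- is that of W.
  repEven-identity : ∀ {p q x t₀ t₁ w₀ w₁} → System 1# p q x x t₀ t₁ w₀ w₁ →
    (w₀ + w₁) * (1# - p * (1# + q) * x - (1# - p ^ 2 * q) * x ^ 2
                    - (1# - p) * (1# + q) * x ^ 3 - (p - 1#) ^ 2 * q * x ^ 4)
      ≈ x * (x * (1# - (p - 1#) * q * (x ^ 2 + x)))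
  repEven-identity {p} {q} {x} {t₀} {t₁} {w₀} {w₁} sys =
    discharge-system sys
      -- Only `eq-t₀` is inhomogeneous, so its multiplier, expanded, is the right-hand side.
      (b * x ^ 2 + q * x ^ 3 * (a + x))
      (x ^ 3 * (b + q * x) + q * x ^ 2 * a)
      (x ^ 2 + a - x ^ 2 * (a + x))
      (b - x ^ 2 * (b + q * x) + q * x ^ 2)
      (solve 7 (λ p q x t₀ t₁ w₀ w₁ →
        let 1# = con (+ 1) ; a = 1# :- p :* x ; b = 1# :- p :* q :* x in
        (w₀ :+ w₁) :* (1# :- p :* (1# :+ q) :* x :- (1# :- p :^ 2 :* q) :* x :^ 2
                          :- (1# :- p) :* (1# :+ q) :* x :^ 3 :- (p :- 1#) :^ 2 :* q :* x :^ 4)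
        := x :* (x :* (1# :- (p :- 1#) :* q :* (x :^ 2 :+ x)))
           :+ (b :* x :^ 2 :+ q :* x :^ 3 :* (a :+ x)) :* (t₀ :- (1# :+ (x :* t₁ :+ w₀)))
           :+ (x :^ 3 :* (b :+ q :* x) :+ q :* x :^ 2 :* a) :* (t₁ :- (x :* t₀ :+ w₁))
           :+ (x :^ 2 :+ a :- x :^ 2 :* (a :+ x)) :* (w₀ :- q :* (1# :* (x :* (x :* t₁)) :+ p :* (x :* w₀)))
           :+ (b :- x :^ 2 :* (b :+ q :* x) :+ q :* x :^ 2) :* (w₁ :- (1# :* (x :* (x :* t₀)) :+ p :* (x :* w₁))))
        refl p q x t₀ t₁ w₀ w₁)
    where
    a = 1# - p * x
    b = 1# - p * q * x

  -- At `q = 1`, with `a = 1 - p x`, the general determinant factors as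
  -- `(a - x (a + x)) (a + x (a + x))`, and the second factor is shared with the numerator. Instead
  -- of cancelling it, the proof adds the parity halves: `t = 1 + x t + w` and `w = x² t + p x w`.
  -- Hence the multipliers agree on both halves.
  rep-identity : ∀ {p x t₀ t₁ w₀ w₁} → System 1# p 1# x x t₀ t₁ w₀ w₁ →
    (w₀ + w₁) * (1# - (1# + p) * x - (1# - p) * x ^ 2) ≈ x * x
  rep-identity {p} {x} {t₀} {t₁} {w₀} {w₁} sys =
    discharge-system sys (x ^ 2) (x ^ 2) (1# - x) (1# - x)
      (solve 6 (λ p x t₀ t₁ w₀ w₁ → let 1# = con (+ 1) in
        (w₀ :+ w₁) :* (1# :- (1# :+ p) :* x :- (1# :- p) :* x :^ 2)
        := x :* x
           :+ x :^ 2 :* (t₀ :- (1# :+ (x :* t₁ :+ w₀)))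
           :+ x :^ 2 :* (t₁ :- (x :* t₀ :+ w₁))
           :+ (1# :- x) :* (w₀ :- 1# :* (1# :* (x :* (x :* t₁)) :+ p :* (x :* w₀)))
           :+ (1# :- x) :* (w₁ :- (1# :* (x :* (x :* t₀)) :+ p :* (x :* w₁))))
        refl p x t₀ t₁ w₀ w₁)

  -- When repetitions are unweighted, the cubic and quartic terms of the general denominator vanish.
  -- The multipliers are those of `repEven-identity` at `p = 1`, simplified.
  even-identity : ∀ {q x t₀ t₁ w₀ w₁} → System 1# 1# q x x t₀ t₁ w₀ w₁ →
    (w₀ + w₁) * (1# - (1# + q) * x - (1# - q) * x ^ 2) ≈ x * x
  even-identity {q} {x} {t₀} {t₁} {w₀} {w₁} sys =
    discharge-system sys (x ^ 2) (x ^ 3 + (1# - x) * (q * x ^ 2)) (1# - x) (1# - x ^ 2 - (1# - x) * (q * x))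
      (solve 6 (λ q x t₀ t₁ w₀ w₁ → let 1# = con (+ 1) in
        (w₀ :+ w₁) :* (1# :- (1# :+ q) :* x :- (1# :- q) :* x :^ 2)
        := x :* x
           :+ x :^ 2 :* (t₀ :- (1# :+ (x :* t₁ :+ w₀)))
           :+ (x :^ 3 :+ (1# :- x) :* (q :* x :^ 2)) :* (t₁ :- (x :* t₀ :+ w₁))
           :+ (1# :- x) :* (w₀ :- q :* (1# :* (x :* (x :* t₁)) :+ 1# :* (x :* w₀)))
           :+ (1# :- x :^ 2 :- (1# :- x) :* (q :* x)) :* (w₁ :- (1# :* (x :* (x :* t₀)) :+ 1# :* (x :* w₁))))
        refl q x t₀ t₁ w₀ w₁)

  -- `A` and `B` count the copies of a single odd or even value: none, or at least one with a single
  -- factor `p`. Raising the bound by one multiplies by `y` and by one of them, so `t₁ = A y t₀` and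
  -- `t₀ = 1 + B y t₁`, a geometric series in `A * B * y ^ 2`.
  distEven-identity : ∀ {p q x y t₀ t₁ w₀ w₁} → System p 1# q x y t₀ t₁ w₀ w₁ →
    (u : Unit (1# - x)) (v : Unit (1# - q * x)) (uv : Unit ((1# - x) * (1# - q * x))) →
    let A = 1# + p * x / (1# - x) ⟨ u ⟩ ; B = 1# + p * q * x / (1# - q * x) ⟨ v ⟩ in
    (s : Unit (1# - A * B * y ^ 2)) →
    w₀ + w₁ ≈ p * x * y / (1# - x) ⟨ u ⟩
      + ( p * q * x / (1# - q * x) ⟨ v ⟩
        + p * x * y * (1# - q * x + p * q * x) / ((1# - x) * (1# - q * x)) ⟨ uv ⟩ )
        * A * y ^ 2 / (1# - A * B * y ^ 2) ⟨ s ⟩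
  distEven-identity {p} {q} {x} {y} {t₀} {t₁} {w₀} {w₁} sys
      u@(i , _) v@(j , _ , j-inv) uv@(ij , _) s@(k , _ , k-inv) = begin
    w₀ + w₁
      ≈⟨ +-cong (trans w₀≈ (*-congʳ (*-congˡ t₁≈))) w₁≈ ⟩
    p * q * x * y * (A * y * t₀) * j + p * x * y * t₀ * i
      ≈⟨ +-cong (*-congʳ (*-congˡ (*-congˡ t₀≈))) (*-congʳ (*-congˡ t₀≈)) ⟩
    p * q * x * y * (A * y * k) * j + p * x * y * k * i
      ≈⟨ assemble ⟩
    p * x * y * i + (p * q * x * j + p * x * y * (1# - q * x + p * q * x) * (i * j)) * A * y ^ 2 * k
      ≈⟨ +-congˡ (*-congʳ (*-congʳ (*-congʳ (+-congˡ (*-congˡ i*j≈ij))))) ⟩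
    p * x * y * i + (p * q * x * j + p * x * y * (1# - q * x + p * q * x) * ij) * A * y ^ 2 * k ∎
    where
    open System sys
    A = 1# + p * x * i

    i*j≈ij : i * j ≈ ij
    i*j≈ij = trans (*-≈⇒≈-/ uv (proj₁ (proj₂ (Unit-* u v)))) (*-identityˡ ij)

    w₁≈ : w₁ ≈ p * x * y * t₀ * i
    w₁≈ = *-≈⇒≈-/ u (discharge 1# (solve 5 (λ p x y t₀ w₁ → let 1# = con (+ 1) in
      w₁ :* (1# :- x) := p :* x :* y :* t₀ :+ 1# :* (w₁ :- (p :* (x :* (y :* t₀)) :+ 1# :* (x :* w₁))))
      refl p x y t₀ w₁) eq-w₁)

    w₀≈ : w₀ ≈ p * q * x * y * t₁ * j
    w₀≈ = *-≈⇒≈-/ v (discharge 1# (solve 6 (λ p q x y t₁ w₀ → let 1# = con (+ 1) in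
      w₀ :* (1# :- q :* x) :=
        p :* q :* x :* y :* t₁ :+ 1# :* (w₀ :- q :* (p :* (x :* (y :* t₁)) :+ 1# :* (x :* w₀))))
      refl p q x y t₁ w₀) eq-w₀)

    t₁≈ : t₁ ≈ A * y * t₀
    t₁≈ = trans eq-t₁ (trans (+-congˡ w₁≈) (solve 5 (λ p x y t₀ i →
      y :* t₀ :+ p :* x :* y :* t₀ :* i := (con (+ 1) :+ p :* x :* i) :* y :* t₀)
      refl p x y t₀ i))

    t₀≈ : t₀ ≈ k
    t₀≈ = trans (*-≈⇒≈-/ s (discharge 1# (solve 5 (λ A pqx j y t₀ → let 1# = con (+ 1) in
      t₀ :* (1# :- A :* (1# :+ pqx :* j) :* y :^ 2) :=
        1# :+ 1# :* (t₀ :- (1# :+ (y :* (A :* y :* t₀) :+ pqx :* y :* (A :* y :* t₀) :* j))))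
      refl A (p * q * x) j y t₀)
      (trans eq-t₀ (+-congˡ (+-cong (*-congˡ t₁≈) (trans w₀≈ (*-congʳ (*-congˡ t₁≈)))))))) (*-identityˡ k)

    assemble : p * q * x * y * (A * y * k) * j + p * x * y * k * i ≈
      p * x * y * i + (p * q * x * j + p * x * y * (1# - q * x + p * q * x) * (i * j)) * A * y ^ 2 * k
    -- `k-inv`, read as `k = 1 + A B y² k`, splits the partitions with largest part 1 off the odd
    -- half. `j-inv` gives `(1 - q x + p q x) j = 1 + p q x j`.
    assemble = discharge (p * x * y * i) (discharge (- (p * x * y * i * A * y ^ 2 * k))
      (solve 8 (λ p q x y i j k A → let 1# = con (+ 1) in
        p :* q :* x :* y :* (A :* y :* k) :* j :+ p :* x :* y :* k :* i :=
        p :* x :* y :* i :+ (p :* q :* x :* j :+ p :* x :* y :* (1# :- q :* x :+ p :* q :* x) :* (i :* j)) :* A :* y :^ 2 :* k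
          :+ p :* x :* y :* i :* ((1# :- A :* (1# :+ p :* q :* x :* j) :* y :^ 2) :* k :- 1#)
          :+ (:- (p :* x :* y :* i :* A :* y :^ 2 :* k)) :* ((1# :- q :* x) :* j :- 1#))
        refl p q x y i j k A) j-inv) k-inv

  -- Deciding definitional equality of power series by unfolding takes time exponential
  -- in the size of the expressions, so an instance has to match distEvenSeries
  -- syntactically.  Hence the operations are arguments, to be spelled as in Bivariate,
  -- and the equation for term is there for unification: it solves p′ and q′ by the
  -- private names used in Bivariate.
  distEven-transport : ∀
    {_+′_ _-′_ _*′_ : Carrier → Carrier → Carrier} {_^′_ : Carrier → ℕ → Carrier}
    {_/′_⟨_⟩ : ∀ a b → Unit b → Carrier} {1′ : Carrier} →
    _+_ ≡ _+′_ → _-_ ≡ _-′_ → _*_ ≡ _*′_ → _^_ ≡ _^′_ →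
    _/_⟨_⟩ ≡ _/′_⟨_⟩ → 1# ≡ 1′ →
    ∀ {p q p′ q′ x y t₀ t₁ w₀ w₁} (term : Partition → Carrier) →
    (∀ π → term π ≡ ((((p′ ^′ dist π) *′ (q′ ^′ even π)) *′ (x ^′ len π)) *′ (y ^′ largest π))) →
    p ≡ p′ → q ≡ q′ → System p 1# q x y t₀ t₁ w₀ w₁ →
    (u : Unit (1′ -′ x)) (v : ∀ a → Unit (1′ -′ (a *′ x)))
    (uv : ∀ {a b} → Unit a → Unit b → Unit (a *′ b)) (s : ∀ a → Unit (1′ -′ (a *′ (y ^′ 2)))) →
    let A = 1′ +′ ((p′ *′ x) /′ (1′ -′ x) ⟨ u ⟩)
        B = 1′ +′ (((p′ *′ q′) *′ x) /′ (1′ -′ (q′ *′ x)) ⟨ v q′ ⟩)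
    in w₀ + w₁ ≈
      ((((p′ *′ x) *′ y) /′ (1′ -′ x) ⟨ u ⟩)
        +′ (((((((p′ *′ q′) *′ x) /′ (1′ -′ (q′ *′ x)) ⟨ v q′ ⟩)
              +′ ((((p′ *′ x) *′ y) *′ ((1′ -′ (q′ *′ x)) +′ ((p′ *′ q′) *′ x)))
                   /′ ((1′ -′ x) *′ (1′ -′ (q′ *′ x))) ⟨ uv u (v q′) ⟩))
             *′ A) *′ (y ^′ 2))
           /′ (1′ -′ ((A *′ B) *′ (y ^′ 2))) ⟨ s (A *′ B) ⟩))
  distEven-transport ≡.refl ≡.refl ≡.refl ≡.refl ≡.refl ≡.refl {q = q} _ _ ≡.refl ≡.refl sys u v uv s =
    distEven-identity sys u (v q) (uv u (v q)) (s _)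

-- Enumeration of partitions

-- The index sets of the coefficients of y^n x^m in T and W: `m` parts, all at most `n`,
-- respectively with largest part `n`. The empty partition occurs only in `bounded`.
bounded exact : ℕ → ℕ → List (List ℕ)
bounded zero    zero    = [] ∷ []
bounded zero    (suc m) = []
bounded (suc n) m       = bounded n m ++ exact (suc n) m

exact zero    m       = []
exact (suc n) zero    = []
exact (suc n) (suc m) = map (suc n ∷_) (bounded (suc n) m)

-- Linked _≥_ (n ∷ l) says that l is weakly decreasing with parts at most n.
record BoundedPartition (n m : ℕ) (l : List ℕ) : Set where
  constructor boundedPartition
  field
    length≡    : length l ≡ m
    positive   : All (_> 0) l
    decreasing : Linked _≥_ (n ∷ l)

Linked-≥-weaken : ∀ {n n′ l} → n ≤ n′ → Linked _≥_ (n ∷ l) → Linked _≥_ (n′ ∷ l)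
Linked-≥-weaken n≤n′ [-]       = [-]
Linked-≥-weaken n≤n′ (n≥k ∷ d) = ℕ.≤-trans n≥k n≤n′ ∷ d

bounded-sound : ∀ n m {l} → l ∈ bounded n m → BoundedPartition n m l
exact-sound   : ∀ n m {l} → l ∈ exact n m → ∃[ l′ ] l ≡ n ∷ l′ × BoundedPartition n m l

bounded-sound zero    zero (here ≡.refl) = boundedPartition ≡.refl [] [-]
bounded-sound (suc n) m    l∈ with ∈-++⁻ (bounded n m) l∈
... | inj₁ l∈ = let boundedPartition eq pos d = bounded-sound n m l∈ in
  boundedPartition eq pos (Linked-≥-weaken (ℕ.n≤1+n n) d)
... | inj₂ l∈ = proj₂ (proj₂ (exact-sound (suc n) m l∈))

exact-sound (suc n) (suc m) l∈ with ∈-map⁻ (suc n ∷_) l∈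
... | l , l∈ , ≡.refl = let boundedPartition eq pos d = bounded-sound (suc n) m l∈ in
  l , ≡.refl , boundedPartition (≡.cong suc eq) (s≤s z≤n ∷ pos) (ℕ.≤-refl ∷ d)

bounded-complete : ∀ n {l} → All (_> 0) l → Linked _≥_ (n ∷ l) → l ∈ bounded n (length l)
exact-complete   : ∀ n {l} → All (_> 0) (n ∷ l) → Linked _≥_ (n ∷ l) → n ∷ l ∈ exact n (suc (length l))

bounded-complete zero    {[]}    _         _         = here ≡.refl
bounded-complete zero    {k ∷ l} (k>0 ∷ _) (0≥k ∷ _) = contradiction k>0 (ℕ.≤⇒≯ 0≥k)
bounded-complete (suc n) {[]}    pos       _         = ∈-++⁺ˡ (bounded-complete n pos [-])
bounded-complete (suc n) {k ∷ l} pos       (n≥k ∷ d) with ℕ.m≤n⇒m<n∨m≡n n≥k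
... | inj₁ (s≤s k≤n) = ∈-++⁺ˡ (bounded-complete n pos (k≤n ∷ d))
... | inj₂ ≡.refl      = ∈-++⁺ʳ (bounded n (length (k ∷ l))) (exact-complete (suc n) pos d)

exact-complete (suc n) (_ ∷ pos) d = ∈-map⁺ (suc n ∷_) (bounded-complete (suc n) pos d)

bounded-unique : ∀ n m → Unique (bounded n m)
exact-unique   : ∀ n m → Unique (exact n m)

bounded-unique zero    zero    = [] ∷ []
bounded-unique zero    (suc m) = []
bounded-unique (suc n) m       = Unique.++⁺ (bounded-unique n m) (exact-unique (suc n) m) disjoint
  where
  disjoint : ∀ {l} → ¬ (l ∈ bounded n m × l ∈ exact (suc n) m)
  disjoint (l∈b , l∈e) with exact-sound (suc n) m l∈e
  ... | _ , ≡.refl , _ = ℕ.1+n≰n (Linked.head (BoundedPartition.decreasing (bounded-sound n m l∈b)))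

exact-unique zero    m       = []
exact-unique (suc n) zero    = []
exact-unique (suc n) (suc m) = Unique.map⁺ ∷-injectiveʳ (bounded-unique (suc n) m)

-- Antidiagonals and partitions of given perimeter

module _ {A : Set} where

  -- Collects `f n m` over `n + m = N`. The recursion shifts the first index exactly as `diagonal`
  -- does, so sums over it become diagonals by a direct induction.
  antidiagonal : (ℕ → ℕ → List A) → ℕ → List A
  antidiagonal f zero    = f 0 0
  antidiagonal f (suc N) = f 0 (suc N) ++ antidiagonal (f ∘ suc) N

  ∈-antidiagonal⁺ : ∀ f n m {a} → a ∈ f n m → a ∈ antidiagonal f (n ℕ.+ m)
  ∈-antidiagonal⁺ f zero    zero    a∈ = a∈
  ∈-antidiagonal⁺ f zero    (suc m) a∈ = ∈-++⁺ˡ a∈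
  ∈-antidiagonal⁺ f (suc n) m       a∈ = ∈-++⁺ʳ (f 0 (suc (n ℕ.+ m))) (∈-antidiagonal⁺ (f ∘ suc) n m a∈)

  ∈-antidiagonal⁻ : ∀ f N {a} → a ∈ antidiagonal f N → ∃[ n ] ∃[ m ] n ℕ.+ m ≡ N × a ∈ f n m
  ∈-antidiagonal⁻ f zero    a∈ = 0 , 0 , ≡.refl , a∈
  ∈-antidiagonal⁻ f (suc N) a∈ with ∈-++⁻ (f 0 (suc N)) a∈
  ... | inj₁ a∈ = 0 , suc N , ≡.refl , a∈
  ... | inj₂ a∈ = let n , m , eq , a∈ = ∈-antidiagonal⁻ (f ∘ suc) N a∈ in suc n , m , ≡.cong suc eq , a∈

  -- On an antidiagonal the first index determines the second, so blocks are disjoint once an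
  -- element fixes its first index.
  antidiagonal-unique : ∀ f → (∀ n m → Unique (f n m)) →
    (∀ {n m n′ m′ a} → a ∈ f n m → a ∈ f n′ m′ → n ≡ n′) → ∀ N → Unique (antidiagonal f N)
  antidiagonal-unique f uniq disj zero    = uniq 0 0
  antidiagonal-unique f uniq disj (suc N) = Unique.++⁺ (uniq 0 (suc N))
    (antidiagonal-unique (f ∘ suc) (uniq ∘ suc) (λ a∈ a∈′ → ℕ.suc-injective (disj a∈ a∈′)) N)
    λ (a∈ , a∈′) → let n , m , _ , a∈′ = ∈-antidiagonal⁻ (f ∘ suc) N a∈′ in ℕ.0≢1+n (disj a∈ a∈′)

-- The successor compensates the `- 1` in the perimeter: largest part plus length is `suc N`.
byPerimeter : ℕ → List (List ℕ)
byPerimeter N = antidiagonal exact (suc N)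

byPerimeter-unique : ∀ N → Unique (byPerimeter N)
byPerimeter-unique N = antidiagonal-unique exact exact-unique same-largest (suc N)
  where
  same-largest : ∀ {n m n′ m′ l} → l ∈ exact n m → l ∈ exact n′ m′ → n ≡ n′
  same-largest {n} {m} {n′} {m′} l∈ l∈′ with exact-sound n m l∈ | exact-sound n′ m′ l∈′
  ... | _ , ≡.refl , _ | _ , ≡.refl , _ = ≡.refl

-- The positivity and monotonicity proofs are unique, so enumerating part lists amounts to
-- enumerating partitions.
partition-≡ : ∀ {π ρ} → partList π ≡ partList ρ → π ≡ ρ
partition-≡ {record { parts = k List⁺.∷ l ; positive = pos ; decreasing = d }}
            {record { parts = k List⁺.∷ l ; positive = pos′ ; decreasing = d′ }} ≡.refl
  with ≡.refl ← All.irrelevant ℕ.<-irrelevant pos pos′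
     | ≡.refl ← Linked.irrelevant ℕ.≤-irrelevant d d′ = ≡.refl

IsPartition : List ℕ → Set
IsPartition l = ∃[ π ] partList π ≡ l

exact-isPartition : ∀ n m {l} → l ∈ exact n m → IsPartition l
exact-isPartition n m l∈ with exact-sound n m l∈
... | l , ≡.refl , boundedPartition _ pos (_ ∷ d) =
  record { parts = n List⁺.∷ l ; positive = pos ; decreasing = d } , ≡.refl

∈-exact : ∀ π → partList π ∈ exact (largest π) (len π)
∈-exact record { parts = n List⁺.∷ l ; positive = pos ; decreasing = d } = exact-complete n pos d

∈-exact⁻ : ∀ n m π → partList π ∈ exact n m → largest π ≡ n × len π ≡ m
∈-exact⁻ n m π l∈ with exact-sound n m l∈
... | _ , ≡.refl , bp = ≡.refl , BoundedPartition.length≡ bp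

-- The statistics when a largest part is added

-- The recursion passes through the empty list, which is no `Partition`, so the statistics are
-- needed on bare lists. On `partList π` they unfold to `dist`, `rep` and `even`.
distinctParts repeatedParts evenParts : List ℕ → ℕ
distinctParts l = length (deduplicate ℕ._≟_ l)
repeatedParts l = length (filter (uncurry ℕ._≟_) (zip l (drop 1 l)))
evenParts l     = length (filter (2 ∣?_) l)

distinctParts-< : ∀ {n l} → Linked _≥_ (n ∷ l) → distinctParts (suc n ∷ l) ≡ suc (distinctParts l)
distinctParts-< {n} {l} d = ≡.cong (suc ∘ length)
  (filter-all (¬? ∘ (suc n ℕ.≟_)) (All.deduplicate⁺ ℕ._≟_ (All.map distinct bound)))
  where
  bound : All (n ≥_) l
  bound = All.tail (Linked⇒All (flip ℕ.≤-trans) ℕ.≤-refl d)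
  distinct : ∀ {k} → n ≥ k → suc n ≢ k
  distinct n≥k ≡.refl = ℕ.1+n≰n n≥k

distinctParts-≡ : ∀ n l → distinctParts (n ∷ n ∷ l) ≡ distinctParts (n ∷ l)
distinctParts-≡ n l = ≡.cong (suc ∘ length) (≡.trans
  (filter-reject (¬? ∘ (n ℕ.≟_)) {xs = filter (¬? ∘ (n ℕ.≟_)) (deduplicate ℕ._≟_ l)} (λ n≢n → n≢n ≡.refl))
  (filter-idem (¬? ∘ (n ℕ.≟_)) (deduplicate ℕ._≟_ l)))

repeatedParts-< : ∀ {n l} → Linked _≥_ (n ∷ l) → repeatedParts (suc n ∷ l) ≡ repeatedParts l
repeatedParts-< {l = []}    _         = ≡.refl
repeatedParts-< {n} {k ∷ l} (n≥k ∷ _) =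
  ≡.cong length (filter-reject (uncurry ℕ._≟_) {x = suc n , k} {xs = zip (k ∷ l) l} λ { ≡.refl → ℕ.1+n≰n n≥k })

repeatedParts-≡ : ∀ n l → repeatedParts (n ∷ n ∷ l) ≡ suc (repeatedParts (n ∷ l))
repeatedParts-≡ n l = ≡.cong length (filter-accept (uncurry ℕ._≟_) {x = n , n} {xs = zip (n ∷ l) l} ≡.refl)

evenParts-∷ : ∀ n l → evenParts (n ∷ l) ≡ evenParts (n ∷ []) ℕ.+ evenParts l
evenParts-∷ n l with does (2 ∣? n)
... | true  = ≡.refl
... | false = ≡.refl

-- Two steps of the remainder by 2 return to the initial state, so both sides reduce to the same
-- test.
evenParts-2+ : ∀ n → evenParts (suc (suc n) ∷ []) ≡ evenParts (n ∷ [])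
evenParts-2+ n with does (2 ∣? n)
... | true  = ≡.refl
... | false = ≡.refl

-- Finite sums over enumerations

module ListSums (R : CommutativeRing c ℓ) where
  open CommutativeRing R
  open Summation R
  open Relation.Binary.Reasoning.Setoid setoid

  listSum-++ : ∀ as bs → listSum (as ++ bs) ≈ listSum as + listSum bs
  listSum-++ []       bs = sym (+-identityˡ _)
  listSum-++ (a ∷ as) bs = trans (+-congˡ (listSum-++ as bs)) (sym (+-assoc _ _ _))

  ∑ : {A : Set} → (A → Carrier) → List A → Carrier
  ∑ f as = listSum (map f as)

  module _ {A : Set} where

    ∑-++ : ∀ (f : A → Carrier) as bs → ∑ f (as ++ bs) ≈ ∑ f as + ∑ f bs
    ∑-++ f as bs = trans (reflexive (≡.cong listSum (map-++ f as bs))) (listSum-++ (map f as) (map f bs))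

    ∑-cong : ∀ {f g : A → Carrier} as → (∀ {a} → a ∈ as → f a ≈ g a) → ∑ f as ≈ ∑ g as
    ∑-cong []       f≈g = refl
    ∑-cong (a ∷ as) f≈g = +-cong (f≈g (here ≡.refl)) (∑-cong as (f≈g ∘ there))

    ∑-scale : ∀ k (f : A → Carrier) as → ∑ (λ a → k * f a) as ≈ k * ∑ f as
    ∑-scale k f []       = sym (zeroʳ k)
    ∑-scale k f (a ∷ as) = trans (+-congˡ (∑-scale k f as)) (sym (distribˡ k _ _))

    ∑-map : ∀ {B : Set} (f : B → Carrier) (g : A → B) as → ∑ f (map g as) ≈ ∑ (f ∘ g) as
    ∑-map f g as = reflexive (≡.cong listSum (≡.sym (map-∘ as)))

  module _ (ls : List (List ℕ)) (unique : Unique ls) (valid : ∀ {l} → l ∈ ls → IsPartition l)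
           {w : List ℕ → Carrier} {f : Partition → Carrier}
           (f≈w : ∀ π → partList π ∈ ls → f π ≈ w (partList π))
           (f≈0 : ∀ π → partList π ∉ ls → f π ≈ 0#)
           where

    private
      reduceAll : ∀ {ls} → All IsPartition ls → List Partition
      reduceAll = All.reduce proj₁

      map-reduceAll : ∀ {ls} (vs : All IsPartition ls) → map partList (reduceAll vs) ≡ ls
      map-reduceAll []              = ≡.refl
      map-reduceAll ((_ , eq) ∷ vs) = ≡.cong₂ _∷_ eq (map-reduceAll vs)

      πs : List Partition
      πs = reduceAll (All.tabulate valid)

      map-πs : map partList πs ≡ ls
      map-πs = map-reduceAll (All.tabulate valid)

      ∈-πs : ∀ π → partList π ∈ ls → π ∈ πs
      ∈-πs π l∈ with ∈-map⁻ partList (≡.subst (partList π ∈_) (≡.sym map-πs) l∈)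
      ... | ρ , ρ∈ , eq = ≡.subst (_∈ πs) (≡.sym (partition-≡ eq)) ρ∈

      ∈-ls : ∀ {π} → π ∈ πs → partList π ∈ ls
      ∈-ls {π} π∈ = ≡.subst (partList π ∈_) map-πs (∈-map⁺ partList π∈)

    -- The enumeration consists of part lists, but the required finite support consists of
    -- partitions. `valid` lifts the lists, uniqueness is reflected along `partList`, and
    -- `partition-≡` makes the two notions of membership agree.
    sumOverEnumeration : ∀ {s} → s ≈ ∑ w ls →
      ∃[ πs ] Unique πs × (∀ π → π ∉ πs → f π ≈ 0#) × s ≈ ∑ f πs
    sumOverEnumeration {s} s≈ = πs , Unique.map⁻ (≡.subst Unique (≡.sym map-πs) unique)
      , (λ π π∉ → f≈0 π (π∉ ∘ ∈-πs π))
      , (begin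
          s                         ≈⟨ s≈ ⟩
          ∑ w ls                    ≡⟨ ≡.cong (∑ w) map-πs ⟨
          ∑ w (map partList πs)     ≈⟨ ∑-map w partList πs ⟩
          ∑ (w ∘ partList) πs       ≈⟨ ∑-cong πs (λ {π} π∈ → f≈w π (∈-ls π∈)) ⟨
          ∑ f πs                    ∎)

-- Weighted sums and their recurrences

module Weights (R : CommutativeRing c ℓ) (p r q : CommutativeRing.Carrier R) where
  open CommutativeRing R
  open Algebra.Properties.Semiring.Exp semiring using (_^_; ^-congʳ; ^-homo-*)
  open ListSums R
  open IntegerCoefficients R using (module Solver)
  open Solver using (solve; _:=_; _:*_)
  open Relation.Binary.Reasoning.Setoid setoid

  weight : List ℕ → Carrier
  weight l = p ^ distinctParts l * r ^ repeatedParts l * q ^ evenParts l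

  evenFactor : ℕ → Carrier
  evenFactor n = q ^ evenParts (n ∷ [])

  private
    -- The exponents are variables so that callers can supply them in successor form, where the
    -- powers unfold.
    weight-∷ : ∀ n l a b → a ≡ distinctParts (n ∷ l) → b ≡ repeatedParts (n ∷ l) →
      weight (n ∷ l) ≈ p ^ a * r ^ b * (evenFactor n * q ^ evenParts l)
    weight-∷ n l a b ≡.refl ≡.refl =
      *-congˡ (trans (^-congʳ q (evenParts-∷ n l)) (^-homo-* q (evenParts (n ∷ [])) (evenParts l)))

  -- A new largest part is either a new value or a repetition, so exactly one of the two exponents
  -- grows. This lemma and `weight-≡` give the two summands in the equations for W.
  weight-< : ∀ {n l} → Linked _≥_ (n ∷ l) → weight (suc n ∷ l) ≈ evenFactor (suc n) * p * weight l
  weight-< {n} {l} d = trans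
    (weight-∷ (suc n) l _ _ (≡.sym (distinctParts-< d)) (≡.sym (repeatedParts-< d)))
    (solve 5 (λ p pᵃ rᵇ e qᶜ → p :* pᵃ :* rᵇ :* (e :* qᶜ) := e :* p :* (pᵃ :* rᵇ :* qᶜ))
      refl p _ _ _ _)

  weight-≡ : ∀ n l → weight (n ∷ n ∷ l) ≈ evenFactor n * r * weight (n ∷ l)
  weight-≡ n l = trans
    (weight-∷ n (n ∷ l) _ _ (≡.sym (distinctParts-≡ n l)) (≡.sym (repeatedParts-≡ n l)))
    (solve 5 (λ r pᵃ rᵇ e qᶜ → pᵃ :* (r :* rᵇ) :* (e :* qᶜ) := e :* r :* (pᵃ :* rᵇ :* qᶜ))
      refl r _ _ _ _)

  boundedSum exactSum : ℕ → ℕ → Carrier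
  boundedSum n m = ∑ weight (bounded n m)
  exactSum n m   = ∑ weight (exact n m)

  boundedSum-suc : ∀ n m → boundedSum (suc n) m ≈ boundedSum n m + exactSum (suc n) m
  boundedSum-suc n m = ∑-++ weight (bounded n m) (exact (suc n) m)

  -- What remains without the largest part lies in `bounded (suc n) m`, whose defining concatenation
  -- already separates smaller parts from a repeated largest part.
  exactSum-suc : ∀ n m → exactSum (suc n) (suc m) ≈
    evenFactor (suc n) * p * boundedSum n m + evenFactor (suc n) * r * exactSum (suc n) m
  exactSum-suc n m = begin
    exactSum (suc n) (suc m)
      ≈⟨ ∑-map weight (suc n ∷_) (bounded (suc n) m) ⟩
    ∑ weight′ (bounded n m ++ exact (suc n) m)
      ≈⟨ ∑-++ weight′ (bounded n m) (exact (suc n) m) ⟩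
    ∑ weight′ (bounded n m) + ∑ weight′ (exact (suc n) m)
      ≈⟨ +-cong (∑-cong (bounded n m) (λ l∈ → weight-< (BoundedPartition.decreasing (bounded-sound n m l∈))))
                (∑-cong (exact (suc n) m) repeated) ⟩
    ∑ (λ l → evenFactor (suc n) * p * weight l) (bounded n m)
      + ∑ (λ l → evenFactor (suc n) * r * weight l) (exact (suc n) m)
      ≈⟨ +-cong (∑-scale _ weight (bounded n m)) (∑-scale _ weight (exact (suc n) m)) ⟩
    evenFactor (suc n) * p * boundedSum n m + evenFactor (suc n) * r * exactSum (suc n) m ∎
    where
    weight′ : List ℕ → Carrier
    weight′ l = weight (suc n ∷ l)
    repeated : ∀ {l} → l ∈ exact (suc n) m → weight′ l ≈ evenFactor (suc n) * r * weight l
    repeated l∈ with exact-sound (suc n) m l∈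
    ... | l , ≡.refl , _ = weight-≡ (suc n) l

  boundedSum-zero : boundedSum 0 0 ≈ 1#
  boundedSum-zero = trans (+-identityʳ _) (trans (*-identityʳ _) (*-identityʳ _))

  -- Indicators of even and odd numbers. They swap definitionally under `suc`, which is how
  -- multiplication by y exchanges the parity halves.
  ε₀ ε₁ : ℕ → Carrier
  ε₀ zero    = 1#
  ε₀ (suc n) = ε₁ n
  ε₁ zero    = 0#
  ε₁ (suc n) = ε₀ n

  ε₀+ε₁≈1 : ∀ n → ε₀ n + ε₁ n ≈ 1#
  ε₀+ε₁≈1 zero    = +-identityʳ 1#
  ε₀+ε₁≈1 (suc n) = trans (+-comm _ _) (ε₀+ε₁≈1 n)

  -- Masked by parity, the factor that depends on `n` becomes a scalar, which makes the equations
  -- linear with constant coefficients.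
  ε₀-evenFactor : ∀ n → ε₀ n * evenFactor n ≈ ε₀ n * q
  ε₀-evenFactor zero          = *-congˡ (*-identityʳ q)
  ε₀-evenFactor (suc zero)    = trans (zeroˡ _) (sym (zeroˡ _))
  ε₀-evenFactor (suc (suc n)) = trans (*-congˡ (^-congʳ q (evenParts-2+ n))) (ε₀-evenFactor n)

  ε₁-evenFactor : ∀ n → ε₁ n * evenFactor n ≈ ε₁ n
  ε₁-evenFactor zero          = zeroˡ _
  ε₁-evenFactor (suc zero)    = *-identityʳ 1#
  ε₁-evenFactor (suc (suc n)) = trans (*-congˡ (^-congʳ q (evenParts-2+ n))) (ε₁-evenFactor n)

-- Power series

1^n≈1 : (R : CommutativeRing c ℓ) → let open CommutativeRing R in
  ∀ n → Algebra.Properties.Semiring.Exp._^_ semiring 1# n ≈ 1#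
1^n≈1 R zero    = CommutativeRing.refl R
1^n≈1 R (suc n) = CommutativeRing.trans R (CommutativeRing.*-identityˡ R _) (1^n≈1 R n)

module SeriesProperties (R : CommutativeRing c ℓ) where
  private
    module R where
      open CommutativeRing R public
      open Algebra.Properties.Semiring.Exp semiring public using (_^_)
  open PowerSeries R
  open Algebra.Properties.Semiring.Exp (CommutativeRing.semiring ring) using (_^_)

  ⊠-congʳ : ∀ {f f′} g → f ≋ f′ → f ⊠ g ≋ f′ ⊠ g
  ⊠-congʳ g f≈f′ = ⊠-cong {g = g} f≈f′ (λ _ → R.refl)

  const-⊠ : ∀ a f n → (const a ⊠ f) n R.≈ a R.* f n
  const-⊠ a f zero    = R.+-identityʳ _
  const-⊠ a f (suc n) = R.trans (R.+-congˡ (⊠-zeroˡ f n)) (R.+-identityʳ _)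

  const-* : ∀ a b → const a ⊠ const b ≋ const (a R.* b)
  const-* a b zero    = const-⊠ a (const b) 0
  const-* a b (suc n) = R.trans (const-⊠ a (const b) (suc n)) (R.zeroʳ a)

  const-^ : ∀ a k → const a ^ k ≋ const (a R.^ k)
  const-^ a zero    n = R.refl
  const-^ a (suc k) n = R.trans (⊠-cong {const a} (λ _ → R.refl) (const-^ a k) n) (const-* a (a R.^ k) n)

  var-⊠-zero : ∀ f → (var ⊠ f) 0 R.≈ R.0#
  var-⊠-zero f = R.trans (R.+-identityʳ _) (R.zeroˡ _)

  var-⊠-suc : ∀ f n → (var ⊠ f) (suc n) R.≈ f n
  var-⊠-suc f n = R.trans (R.+-cong (R.zeroˡ _) (R.trans (⊠-congʳ f tail-var n) (⊠-identityˡ f n)))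
                          (R.+-identityˡ _)
    where
    tail-var : (λ n → var (suc n)) ≋ 𝟙
    tail-var zero    = R.refl
    tail-var (suc n) = R.refl

  -- Multiplication by the variable only shifts coefficients, so it is injective over any ring, zero
  -- divisors or not.
  var-cancel : ∀ f g → var ⊠ f ≋ var ⊠ g → f ≋ g
  var-cancel f g eq n = R.trans (R.sym (var-⊠-suc f n)) (R.trans (eq (suc n)) (var-⊠-suc g n))

  var-^-≡ : ∀ k → (var ^ k) k R.≈ R.1#
  var-^-≡ zero    = R.refl
  var-^-≡ (suc k) = R.trans (var-⊠-suc (var ^ k) k) (var-^-≡ k)

  var-^-≢ : ∀ k n → k ≢ n → (var ^ k) n R.≈ R.0#
  var-^-≢ zero    zero    0≢0 = contradiction ≡.refl 0≢0
  var-^-≢ zero    (suc n) _   = R.refl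
  var-^-≢ (suc k) zero    _   = var-⊠-zero (var ^ k)
  var-^-≢ (suc k) (suc n) k≢n = R.trans (var-⊠-suc (var ^ k) n) (var-^-≢ k n (k≢n ∘ ≡.cong suc))

  module _ {f a} (f≈a : f ≋ const a) where

    monomial-≡ : ∀ k → (f ⊠ var ^ k) k R.≈ a
    monomial-≡ k = R.trans (⊠-congʳ (var ^ k) f≈a k)
      (R.trans (const-⊠ a (var ^ k) k) (R.trans (R.*-congˡ (var-^-≡ k)) (R.*-identityʳ a)))

    monomial-≢ : ∀ k n → k ≢ n → (f ⊠ var ^ k) n R.≈ R.0#
    monomial-≢ k n k≢n = R.trans (⊠-congʳ (var ^ k) f≈a n)
      (R.trans (const-⊠ a (var ^ k) n) (R.trans (R.*-congˡ (var-^-≢ k n k≢n)) (R.zeroʳ a)))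

  const-^-*-^ : ∀ a b k l → const a ^ k ⊠ const b ^ l ≋ const (a R.^ k R.* b R.^ l)
  const-^-*-^ a b k l n = R.trans (⊠-cong (const-^ a k) (const-^ b l) n) (const-* (a R.^ k) (b R.^ l) n)

module BivariateProperties (R : CommutativeRing c ℓ) where
  private
    module R = CommutativeRing R
    module X where
      open PowerSeries R public
      open SeriesProperties R public
    module Y where
      open PowerSeries X.ring public
      open SeriesProperties X.ring public
  open Bivariate R

  const-coeff : ∀ a f n m → (const a * f) n m R.≈ a R.* f n m
  const-coeff a f n m = R.trans (Y.const-⊠ (X.const a) f n m) (X.const-⊠ a (f n) m)

  x-coeff-zero : ∀ f n → (x * f) n 0 R.≈ R.0#
  x-coeff-zero f n = R.trans (Y.const-⊠ X.var f n 0) (X.var-⊠-zero (f n))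

  x-coeff-suc : ∀ f n m → (x * f) n (suc m) R.≈ f n m
  x-coeff-suc f n m = R.trans (Y.const-⊠ X.var f n (suc m)) (X.var-⊠-suc (f n) m)

  y-coeff-zero : ∀ f m → (y * f) 0 m R.≈ R.0#
  y-coeff-zero f = Y.var-⊠-zero f

  y-coeff-suc : ∀ f n m → (y * f) (suc n) m R.≈ f n m
  y-coeff-suc f n = Y.var-⊠-suc f n

  xy-coeff-zero : ∀ f m → (x * (y * f)) 0 m R.≈ R.0#
  xy-coeff-zero f zero    = x-coeff-zero (y * f) 0
  xy-coeff-zero f (suc m) = R.trans (x-coeff-suc (y * f) 0 m) (y-coeff-zero f m)

  xy-coeff-suc : ∀ f n m → (x * (y * f)) (suc n) (suc m) R.≈ f n m
  xy-coeff-suc f n m = R.trans (x-coeff-suc (y * f) (suc n) m) (y-coeff-suc f n m)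

-- The substitution y = x.
module Diagonal (R : CommutativeRing c ℓ) where
  private
    module R = CommutativeRing R
    module X where
      open PowerSeries R public
      open SeriesProperties R public
    module B where
      open Bivariate R public
      open BivariateProperties R public
  open Univariate R
  open ListSums R

  -- The equations of `System` are built from sums, 1 and left multiplications by constants, `x` and
  -- `y`. Compatibility with exactly these carries the system across the substitution.
  diagonal : B.Carrier → Carrier
  diagonal f zero    = f 0 0
  diagonal f (suc N) = f 0 (suc N) R.+ diagonal (f ∘ suc) N

  diagonal-cong : ∀ {f g} → f B.≈ g → diagonal f ≈ diagonal g
  diagonal-cong f≈g zero    = f≈g 0 0
  diagonal-cong f≈g (suc N) = R.+-cong (f≈g 0 (suc N)) (diagonal-cong (f≈g ∘ suc) N)

  diagonal-+ : ∀ f g → diagonal (f B.+ g) ≈ diagonal f + diagonal g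
  diagonal-+ f g zero    = R.refl
  diagonal-+ f g (suc N) = R.trans (R.+-congˡ (diagonal-+ (f ∘ suc) (g ∘ suc) N)) (interchange _ _ _ _)
    where open Algebra.Properties.CommutativeSemigroup R.+-commutativeSemigroup using (interchange)

  diagonal-0 : diagonal B.0# ≈ 0#
  diagonal-0 zero    = R.refl
  diagonal-0 (suc N) = R.trans (R.+-identityˡ _) (diagonal-0 N)

  diagonal-1 : diagonal B.1# ≈ 1#
  diagonal-1 zero    = R.refl
  diagonal-1 (suc N) = R.trans (R.+-identityˡ _) (diagonal-0 N)

  private
    -- Here and in `diagonal-shift`, `g` is described by its coefficients: the induction drops rows,
    -- and `g ∘ suc` would no longer be visibly a product.
    diagonal-scale : ∀ a f g → (∀ n m → g n m R.≈ a R.* f n m) → ∀ N → diagonal g N R.≈ a R.* diagonal f N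
    diagonal-scale a f g g≈ zero    = g≈ 0 0
    diagonal-scale a f g g≈ (suc N) = R.trans
      (R.+-cong (g≈ 0 (suc N)) (diagonal-scale a (f ∘ suc) (g ∘ suc) (g≈ ∘ suc) N))
      (R.sym (R.distribˡ a _ _))

    diagonal-shift : ∀ f g → (∀ n → g n 0 R.≈ R.0#) → (∀ n m → g n (suc m) R.≈ f n m) →
      ∀ N → diagonal g (suc N) R.≈ diagonal f N
    diagonal-shift f g g₀ g₊ zero    = R.trans (R.+-cong (g₊ 0 0) (g₀ 1)) (R.+-identityʳ _)
    diagonal-shift f g g₀ g₊ (suc N) =
      R.+-cong (g₊ 0 (suc N)) (diagonal-shift (f ∘ suc) (g ∘ suc) (g₀ ∘ suc) (g₊ ∘ suc) N)

  diagonal-const : ∀ a f → diagonal (B.const a B.* f) ≈ const a * diagonal f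
  diagonal-const a f N = R.trans (diagonal-scale a f (B.const a B.* f) (B.const-coeff a f) N)
                                 (R.sym (X.const-⊠ a (diagonal f) N))

  diagonal-x : ∀ f → diagonal (B.x B.* f) ≈ x * diagonal f
  diagonal-x f zero    = R.trans (B.x-coeff-zero f 0) (R.sym (X.var-⊠-zero (diagonal f)))
  diagonal-x f (suc N) = R.trans (diagonal-shift f (B.x B.* f) (B.x-coeff-zero f) (B.x-coeff-suc f) N)
                                 (R.sym (X.var-⊠-suc (diagonal f) N))

  diagonal-y : ∀ f → diagonal (B.y B.* f) ≈ x * diagonal f
  diagonal-y f zero    = R.trans (B.y-coeff-zero f 0) (R.sym (X.var-⊠-zero (diagonal f)))
  diagonal-y f (suc N) = R.trans
    (R.+-cong (B.y-coeff-zero f (suc N)) (diagonal-cong (B.y-coeff-suc f) N))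
    (R.trans (R.+-identityˡ _) (R.sym (X.var-⊠-suc (diagonal f) N)))

  ∑-antidiagonal : ∀ {A : Set} (w : A → R.Carrier) f N →
    ∑ w (antidiagonal f N) R.≈ diagonal (λ n m → ∑ w (f n m)) N
  ∑-antidiagonal w f zero    = R.refl
  ∑-antidiagonal w f (suc N) = R.trans (∑-++ w (f 0 (suc N)) (antidiagonal (f ∘ suc) N))
                                       (R.+-congˡ (∑-antidiagonal w (f ∘ suc) N))

  module _ {p r q t₀ t₁ w₀ w₁}
           (sys : Algebraic.System B.ring (B.const p) (B.const r) (B.const q) B.x B.y t₀ t₁ w₀ w₁) where
    open CommutativeRing ring using (trans; +-cong; *-congˡ)
    open Algebraic.System sys

    private
      diagonal-xy : ∀ f → diagonal (B.x B.* (B.y B.* f)) ≈ x * (x * diagonal f)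
      diagonal-xy f = trans (diagonal-x (B.y B.* f)) (*-congˡ {x} (diagonal-y f))

      diagonal-w : ∀ t w → diagonal (B.const p B.* (B.x B.* (B.y B.* t)) B.+ B.const r B.* (B.x B.* w))
        ≈ const p * (x * (x * diagonal t)) + const r * (x * diagonal w)
      diagonal-w t w = trans (diagonal-+ (B.const p B.* (B.x B.* (B.y B.* t))) (B.const r B.* (B.x B.* w)))
        (+-cong (trans (diagonal-const p (B.x B.* (B.y B.* t))) (*-congˡ {const p} (diagonal-xy t)))
                (trans (diagonal-const r (B.x B.* w)) (*-congˡ {const r} (diagonal-x w))))

    diagonal-system : Algebraic.System ring (const p) (const r) (const q) x x
                        (diagonal t₀) (diagonal t₁) (diagonal w₀) (diagonal w₁)
    diagonal-system = record
      { eq-t₀ = trans (diagonal-cong eq-t₀) (trans (diagonal-+ B.1# (B.y B.* t₁ B.+ w₀))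
          (+-cong diagonal-1 (trans (diagonal-+ (B.y B.* t₁) w₀) (+-cong (diagonal-y t₁) (λ _ → R.refl)))))
      ; eq-t₁ = trans (diagonal-cong eq-t₁) (trans (diagonal-+ (B.y B.* t₀) w₁)
          (+-cong (diagonal-y t₀) (λ _ → R.refl)))
      ; eq-w₀ = trans (diagonal-cong eq-w₀) (trans
          (diagonal-const q (B.const p B.* (B.x B.* (B.y B.* t₁)) B.+ B.const r B.* (B.x B.* w₀)))
          (*-congˡ {const q} (diagonal-w t₁ w₀)))
      ; eq-w₁ = trans (diagonal-cong eq-w₁) (diagonal-w t₀ w₁)
      }

-- The partition series satisfy the system

module PartitionSeries (R : CommutativeRing c ℓ) (p r q : CommutativeRing.Carrier R) where
  open CommutativeRing R
  open Weights R p r q public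
  open IntegerCoefficients R using (module Solver)
  open Solver using (solve; _:=_; _:*_; _:+_)
  open Relation.Binary.Reasoning.Setoid setoid
  private
    module B where
      open Bivariate R public
      open BivariateProperties R public
    module U = Univariate R
    module D = Diagonal R

  t₀ t₁ w₀ w₁ : B.Carrier
  t₀ n m = ε₀ n * boundedSum n m
  t₁ n m = ε₁ n * boundedSum n m
  w₀ n m = ε₀ n * exactSum n m
  w₁ n m = ε₁ n * exactSum n m

  private
    vanish : ∀ {a b} → a ≈ 0# → b ≈ 0# → p * a + r * b ≈ 0#
    vanish a≈0 b≈0 = trans
      (+-cong (trans (*-congˡ a≈0) (zeroʳ p)) (trans (*-congˡ b≈0) (zeroʳ r))) (+-identityʳ 0#)

    w-coeff : ∀ t w n m →
      (B.const p B.* (B.x B.* (B.y B.* t)) B.+ B.const r B.* (B.x B.* w)) n m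
        ≈ p * (B.x B.* (B.y B.* t)) n m + r * (B.x B.* w) n m
    w-coeff t w n m = +-cong (B.const-coeff p (B.x B.* (B.y B.* t)) n m) (B.const-coeff r (B.x B.* w) n m)

    w-coeff-zeroˡ : ∀ t w → (∀ m → w 0 m ≈ 0#) → ∀ m →
      (B.const p B.* (B.x B.* (B.y B.* t)) B.+ B.const r B.* (B.x B.* w)) 0 m ≈ 0#
    w-coeff-zeroˡ t w w≈0 m = trans (w-coeff t w 0 m) (vanish (B.xy-coeff-zero t m) (x-w m))
      where
      x-w : ∀ m → (B.x B.* w) 0 m ≈ 0#
      x-w zero    = B.x-coeff-zero w 0
      x-w (suc m) = trans (B.x-coeff-suc w 0 m) (w≈0 m)

    w-coeff-zeroʳ : ∀ t w n →
      (B.const p B.* (B.x B.* (B.y B.* t)) B.+ B.const r B.* (B.x B.* w)) n 0 ≈ 0#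
    w-coeff-zeroʳ t w n = trans (w-coeff t w n 0) (vanish (B.x-coeff-zero (B.y B.* t) n) (B.x-coeff-zero w n))

    w-coeff-suc : ∀ t w n m →
      (B.const p B.* (B.x B.* (B.y B.* t)) B.+ B.const r B.* (B.x B.* w)) (suc n) (suc m)
        ≈ p * t n m + r * w (suc n) m
    w-coeff-suc t w n m = trans (w-coeff t w (suc n) (suc m))
      (+-cong (*-congˡ (B.xy-coeff-suc t n m)) (*-congˡ (B.x-coeff-suc w (suc n) m)))

    boundedSum-eq : ∀ {ε} n m → ε * boundedSum (suc n) m ≈ ε * boundedSum n m + ε * exactSum (suc n) m
    boundedSum-eq n m = trans (*-congˡ (boundedSum-suc n m)) (distribˡ _ _ _)

    exactSum-eq : ∀ ε n m → ε * exactSum (suc n) (suc m) ≈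
      (ε * evenFactor (suc n)) * (p * boundedSum n m + r * exactSum (suc n) m)
    exactSum-eq ε n m = trans (*-congˡ (exactSum-suc n m))
      (solve 6 (λ ε e p b r w → ε :* (e :* p :* b :+ e :* r :* w) := (ε :* e) :* (p :* b :+ r :* w))
        refl ε (evenFactor (suc n)) p (boundedSum n m) r (exactSum (suc n) m))

    regroup : ∀ ε k b w → (ε * k) * (p * b + r * w) ≈ k * (p * (ε * b) + r * (ε * w))
    regroup ε k b w = solve 6 (λ ε k p b r w →
      (ε :* k) :* (p :* b :+ r :* w) := k :* (p :* (ε :* b) :+ r :* (ε :* w))) refl ε k p b r w

  -- The `1` is the empty partition under the bound 0. For positive even bounds it is inherited
  -- through `y * t₁`.
  eq-t₀ : t₀ B.≈ B.1# B.+ (B.y B.* t₁ B.+ w₀)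
  eq-t₀ zero zero = begin
    1# * boundedSum 0 0                    ≈⟨ trans (*-identityˡ _) boundedSum-zero ⟩
    1#                                     ≈⟨ +-identityʳ 1# ⟨
    1# + 0#                                ≈⟨ +-congˡ (+-identityʳ 0#) ⟨
    1# + (0# + 0#)                         ≈⟨ +-congˡ (+-cong (B.y-coeff-zero t₁ 0) (zeroʳ 1#)) ⟨
    1# + ((B.y B.* t₁) 0 0 + 1# * 0#)      ∎
  eq-t₀ zero (suc m) = begin
    1# * 0#                                ≈⟨ +-identityˡ _ ⟨
    0# + 1# * 0#                           ≈⟨ +-congʳ (B.y-coeff-zero t₁ (suc m)) ⟨
    (B.y B.* t₁) 0 (suc m) + 1# * 0#       ≈⟨ +-identityˡ _ ⟨
    0# + ((B.y B.* t₁) 0 (suc m) + 1# * 0#) ∎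
  eq-t₀ (suc n) m = begin
    t₀ (suc n) m                              ≈⟨ boundedSum-eq n m ⟩
    t₁ n m + w₀ (suc n) m                     ≈⟨ +-congʳ (B.y-coeff-suc t₁ n m) ⟨
    (B.y B.* t₁) (suc n) m + w₀ (suc n) m     ≈⟨ +-identityˡ _ ⟨
    0# + ((B.y B.* t₁) (suc n) m + w₀ (suc n) m) ∎

  eq-t₁ : t₁ B.≈ B.y B.* t₀ B.+ w₁
  eq-t₁ zero m = begin
    0# * boundedSum 0 m             ≈⟨ zeroˡ _ ⟩
    0#                              ≈⟨ +-identityʳ 0# ⟨
    0# + 0#                         ≈⟨ +-cong (B.y-coeff-zero t₀ m) (zeroˡ _) ⟨
    (B.y B.* t₀) 0 m + 0# * 0#      ∎
  eq-t₁ (suc n) m = trans (boundedSum-eq n m) (+-congʳ (sym (B.y-coeff-suc t₀ n m)))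

  eq-w₀ : w₀ B.≈ B.const q B.* (B.const p B.* (B.x B.* (B.y B.* t₁)) B.+ B.const r B.* (B.x B.* w₀))
  eq-w₀ n m = trans (coeff n m) (sym (B.const-coeff q rhs n m))
    where
    rhs = B.const p B.* (B.x B.* (B.y B.* t₁)) B.+ B.const r B.* (B.x B.* w₀)
    coeff : ∀ n m → w₀ n m ≈ q * rhs n m
    coeff zero    m       = trans (zeroʳ _) (sym (trans (*-congˡ (w-coeff-zeroˡ t₁ w₀ (λ _ → zeroʳ _) m)) (zeroʳ q)))
    coeff (suc n) zero    = trans (zeroʳ _) (sym (trans (*-congˡ (w-coeff-zeroʳ t₁ w₀ (suc n))) (zeroʳ q)))
    coeff (suc n) (suc m) = begin
      w₀ (suc n) (suc m)
        ≈⟨ exactSum-eq (ε₁ n) n m ⟩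
      ε₁ n * evenFactor (suc n) * (p * boundedSum n m + r * exactSum (suc n) m)
        -- `ε₁ n` is `ε₀ (suc n)`, so only even largest parts `suc n` survive.
        ≈⟨ *-congʳ (ε₀-evenFactor (suc n)) ⟩
      ε₁ n * q * (p * boundedSum n m + r * exactSum (suc n) m)
        ≈⟨ regroup (ε₁ n) q (boundedSum n m) (exactSum (suc n) m) ⟩
      q * (p * t₁ n m + r * w₀ (suc n) m)
        ≈⟨ *-congˡ (w-coeff-suc t₁ w₀ n m) ⟨
      q * rhs (suc n) (suc m) ∎

  eq-w₁ : w₁ B.≈ B.const p B.* (B.x B.* (B.y B.* t₀)) B.+ B.const r B.* (B.x B.* w₁)
  eq-w₁ zero    m       = trans (zeroʳ _) (sym (w-coeff-zeroˡ t₀ w₁ (λ _ → zeroʳ _) m))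
  eq-w₁ (suc n) zero    = trans (zeroʳ _) (sym (w-coeff-zeroʳ t₀ w₁ (suc n)))
  eq-w₁ (suc n) (suc m) = begin
    w₁ (suc n) (suc m)
      ≈⟨ exactSum-eq (ε₀ n) n m ⟩
    ε₀ n * evenFactor (suc n) * (p * boundedSum n m + r * exactSum (suc n) m)
      -- The inserted `1#` takes the place that `q` has on the even half, so that `regroup` applies.
      ≈⟨ *-congʳ (trans (ε₁-evenFactor (suc n)) (sym (*-identityʳ _))) ⟩
    ε₀ n * 1# * (p * boundedSum n m + r * exactSum (suc n) m)
      ≈⟨ trans (regroup (ε₀ n) 1# (boundedSum n m) (exactSum (suc n) m)) (*-identityˡ _) ⟩
    p * t₀ n m + r * w₁ (suc n) m
      ≈⟨ w-coeff-suc t₀ w₁ n m ⟨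
    (B.const p B.* (B.x B.* (B.y B.* t₀)) B.+ B.const r B.* (B.x B.* w₁)) (suc n) (suc m) ∎

  system : Algebraic.System B.ring (B.const p) (B.const r) (B.const q) B.x B.y t₀ t₁ w₀ w₁
  system = record { eq-t₀ = eq-t₀ ; eq-t₁ = eq-t₁ ; eq-w₀ = eq-w₀ ; eq-w₁ = eq-w₁ }

  w₀+w₁≈exactSum : w₀ B.+ w₁ B.≈ exactSum
  w₀+w₁≈exactSum n m = trans (sym (distribʳ _ _ _)) (trans (*-congʳ (ε₀+ε₁≈1 n)) (*-identityˡ _))

  perimeterSum : U.Carrier
  perimeterSum N = ListSums.∑ R weight (byPerimeter N)

  -- At y = x the exponent is largest part plus length, one more than the perimeter; this is the
  -- factor `x`.
  diagonal-w₀+w₁ : D.diagonal w₀ U.+ D.diagonal w₁ U.≈ U.x U.* perimeterSum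
  diagonal-w₀+w₁ N = trans (sym (D.diagonal-+ w₀ w₁ N)) (trans (D.diagonal-cong w₀+w₁≈exactSum N) (coeff N))
    where
    coeff : D.diagonal exactSum U.≈ U.x U.* perimeterSum
    coeff zero    = sym (SeriesProperties.var-⊠-zero R perimeterSum)
    coeff (suc N) = trans (sym (D.∑-antidiagonal weight exact (suc N)))
                          (sym (SeriesProperties.var-⊠-suc R perimeterSum N))

  perimeterSum-/ : ∀ {n d} (u : U.Unit d) →
    (D.diagonal w₀ U.+ D.diagonal w₁) U.* d U.≈ U.x U.* n → perimeterSum U.≈ n U./ d ⟨ u ⟩
  perimeterSum-/ {n} {d} u eq = Algebraic.*-≈⇒≈-/ U.ring u
    (SeriesProperties.var-cancel R (perimeterSum U.* d) n
      (S.trans (S.sym (S.*-assoc U.x perimeterSum d)) (S.trans (S.*-congʳ {d} (S.sym diagonal-w₀+w₁)) eq)))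
    where module S = CommutativeRing U.ring

-- A partition is nonempty, so the truncated subtraction in the perimeter is exact.
suc-perimeter : ∀ π → suc (perimeter π) ≡ largest π ℕ.+ len π
suc-perimeter record { parts = n List⁺.∷ l } rewrite ℕ.+-suc n (length l) = ≡.refl

∈-byPerimeter⁺ : ∀ π → partList π ∈ byPerimeter (perimeter π)
∈-byPerimeter⁺ π = ≡.subst (λ N → partList π ∈ antidiagonal exact N) (≡.sym (suc-perimeter π))
  (∈-antidiagonal⁺ exact (largest π) (len π) (∈-exact π))

∈-byPerimeter⁻ : ∀ N π → partList π ∈ byPerimeter N → perimeter π ≡ N
∈-byPerimeter⁻ N π l∈ with ∈-antidiagonal⁻ exact (suc N) l∈
... | n , m , n+m≡1+N , l∈ with ≡.refl , ≡.refl ← ∈-exact⁻ n m π l∈ =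
  ℕ.suc-injective (≡.trans (suc-perimeter π) n+m≡1+N)

byPerimeter-isPartition : ∀ N {l} → l ∈ byPerimeter N → IsPartition l
byPerimeter-isPartition N l∈ =
  let n , m , _ , l∈ = ∈-antidiagonal⁻ exact (suc N) l∈ in exact-isPartition n m l∈

-- The four generating functions

module GeneratingFunctions (R : CommutativeRing c ℓ) where
  private
    module R where
      open CommutativeRing R public
      open Algebra.Properties.Semiring.Exp semiring public using (_^_)
    module X where
      open PowerSeries R public
      open SeriesProperties R public
    module Y where
      open PowerSeries X.ring public
      open SeriesProperties X.ring public
    module U = Univariate R
    module B = Bivariate R
  open PartitionSeries R
  open ListSums R

  private
    -- `g` is the coefficient as written in the term, a product of powers of constant series, and
    -- `a` is its value in `R`. The last hypothesis is the cleared form supplied by the algebraic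
    -- identities.
    hasSum-perimeter : ∀ p r q {n d} (u : U.Unit d)
      (g : Partition → U.Carrier) (a : Partition → R.Carrier) →
      (∀ π → g π U.≈ U.const (a π)) → (∀ π → a π R.≈ weight p r q (partList π)) →
      (Diagonal.diagonal R (w₀ p r q) U.+ Diagonal.diagonal R (w₁ p r q)) U.* d U.≈ U.x U.* n →
      U.HasSum (λ π → g π U.* U.x U.^ perimeter π) (n U./ d ⟨ u ⟩)
    hasSum-perimeter p r q u g a g≈a a≈weight eq N =
      sumOverEnumeration (byPerimeter N) (byPerimeter-unique N) (byPerimeter-isPartition N)
        member nonmember (R.sym (perimeterSum-/ p r q u eq N))
      where
      member : ∀ π → partList π ∈ byPerimeter N → (g π U.* U.x U.^ perimeter π) N R.≈ weight p r q (partList π)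
      member π l∈ with ≡.refl ← ∈-byPerimeter⁻ N π l∈ = R.trans (X.monomial-≡ (g≈a π) (perimeter π)) (a≈weight π)

      nonmember : ∀ π → partList π ∉ byPerimeter N → (g π U.* U.x U.^ perimeter π) N R.≈ R.0#
      nonmember π l∉ = X.monomial-≢ (g≈a π) (perimeter π) N λ { ≡.refl → l∉ (∈-byPerimeter⁺ π) }

    diagonalSystem : ∀ p r q → Algebraic.System U.ring (U.const p) (U.const r) (U.const q) U.x U.x _ _ _ _
    diagonalSystem p r q = Diagonal.diagonal-system R (system p r q)

  repEven-hasSum : ∀ p q → U.HasSum (U.repEvenTerm p q) (U.repEvenSeries p q)
  repEven-hasSum p q = hasSum-perimeter R.1# p q (U.repEvenUnit (U.const p) (U.const q))
    (λ π → U.const p U.^ rep π U.* U.const q U.^ even π)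
    (λ π → p R.^ rep π R.* q R.^ even π)
    (λ π → X.const-^-*-^ p q (rep π) (even π))
    (λ π → R.*-congʳ (R.trans (R.sym (R.*-identityˡ _)) (R.*-congʳ (R.sym (1^n≈1 R (dist π))))))
    (Algebraic.repEven-identity U.ring (diagonalSystem R.1# p q))

  rep-hasSum : ∀ p → U.HasSum (U.repTerm p) (U.perimeterSeries p)
  rep-hasSum p = hasSum-perimeter R.1# p R.1# (U.perimeterUnit (U.const p))
    (λ π → U.const p U.^ rep π) (λ π → p R.^ rep π) (λ π → X.const-^ p (rep π))
    (λ π → R.sym (R.trans (R.*-cong (R.trans (R.*-congʳ (1^n≈1 R (dist π))) (R.*-identityˡ _)) (1^n≈1 R (even π)))
                          (R.*-identityʳ _)))
    (Algebraic.rep-identity U.ring (diagonalSystem R.1# p R.1#))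

  even-hasSum : ∀ p → U.HasSum (U.evenTerm p) (U.perimeterSeries p)
  even-hasSum p = hasSum-perimeter R.1# R.1# p (U.perimeterUnit (U.const p))
    (λ π → U.const p U.^ even π) (λ π → p R.^ even π) (λ π → X.const-^ p (even π))
    (λ π → R.sym (R.trans (R.*-congʳ (R.trans (R.*-cong (1^n≈1 R (dist π)) (1^n≈1 R (rep π))) (R.*-identityˡ _)))
                          (R.*-identityˡ _)))
    (Algebraic.even-identity U.ring (diagonalSystem R.1# R.1# p))

  distEven-hasSum : ∀ p q → B.HasSum (B.distEvenTerm p q) (B.distEvenSeries p q)
  distEven-hasSum p q (m , n) = sumOverEnumeration (exact n m) (exact-unique n m) (exact-isPartition n m)
    member nonmember (R.trans (R.sym (closed n m)) (w₀+w₁≈exactSum p R.1# q n m))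
    where
    closed : w₀ p R.1# q B.+ w₁ p R.1# q B.≈ B.distEvenSeries p q
    closed = transported
      where
      transported = Algebraic.distEven-transport (Bivariate.ring R)
        {Bivariate._+_ R} {Bivariate._-_ R} {Bivariate._*_ R} {Bivariate._^_ R} {Bivariate._/_⟨_⟩ R} {Bivariate.1# R}
        ≡.refl ≡.refl ≡.refl ≡.refl ≡.refl ≡.refl
        {p = Bivariate.const R p} {q = Bivariate.const R q} {x = Bivariate.x R} {y = Bivariate.y R}
        (Bivariate.distEvenTerm R p q) (λ π → ≡.refl) ≡.refl ≡.refl (system p R.1# q)
        (Bivariate.1-x-unit R) (Bivariate.1-ax-unit R) (Bivariate.Unit-* R) (Bivariate.1-fy²-unit R)

    coefficient : Partition → X.Series
    coefficient π = (X.const p U.^ dist π X.⊠ X.const q U.^ even π) X.⊠ X.var U.^ len π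

    term : Partition → B.Carrier
    term π = B.const p B.^ dist π B.* B.const q B.^ even π B.* B.x B.^ len π

    -- Relative to y, even the power of x is a constant. The monomial lemmas then apply twice, to y
    -- over the series in x and to x over `R`.
    term≈ : ∀ π → term π B.≈ Y.const (coefficient π)
    term≈ π k = CommutativeRing.trans X.ring
      (Y.⊠-cong (Y.const-^-*-^ (X.const p) (X.const q) (dist π) (even π)) (Y.const-^ X.var (len π)) k)
      (Y.const-* (X.const p U.^ dist π X.⊠ X.const q U.^ even π) (X.var U.^ len π) k)

    member : ∀ π → partList π ∈ exact n m → B.distEvenTerm p q π n m R.≈ weight p R.1# q (partList π)
    member π l∈ with ≡.refl , ≡.refl ← ∈-exact⁻ n m π l∈ =
      R.trans (Y.monomial-≡ (term≈ π) (largest π) (len π))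
     (R.trans (X.monomial-≡ (X.const-^-*-^ p q (dist π) (even π)) (len π))
              (R.*-congʳ (R.sym (R.trans (R.*-congˡ (1^n≈1 R (rep π))) (R.*-identityʳ _)))))

    nonmember : ∀ π → partList π ∉ exact n m → B.distEvenTerm p q π n m R.≈ R.0#
    nonmember π l∉ with largest π ℕ.≟ n | len π ℕ.≟ m
    ... | no  l≢n    | _          = Y.monomial-≢ (term≈ π) (largest π) n l≢n m
    ... | yes ≡.refl | no  len≢m  = R.trans (Y.monomial-≡ (term≈ π) (largest π) m)
                                            (X.monomial-≢ (X.const-^-*-^ p q (dist π) (even π)) (len π) m len≢m)
    ... | yes ≡.refl | yes ≡.refl = contradiction (∈-exact π) l∉

theorem2p4 : Bivariate.HasSum ℤ[p,q].ring
    (Bivariate.distEvenTerm ℤ[p,q].ring ℤ[p,q].p ℤ[p,q].q)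
    (Bivariate.distEvenSeries ℤ[p,q].ring ℤ[p,q].p ℤ[p,q].q)
    × Univariate.HasSum ℤ[p,q].ring
    (Univariate.repEvenTerm ℤ[p,q].ring ℤ[p,q].p ℤ[p,q].q)
    (Univariate.repEvenSeries ℤ[p,q].ring ℤ[p,q].p ℤ[p,q].q)
    × Univariate.HasSum ℤ[p].ring
    (Univariate.repTerm ℤ[p].ring ℤ[p].p)
    (Univariate.perimeterSeries ℤ[p].ring ℤ[p].p)
    × Univariate.HasSum ℤ[p].ring
    (Univariate.evenTerm ℤ[p].ring ℤ[p].p)
    (Univariate.perimeterSeries ℤ[p].ring ℤ[p].p)
theorem2p4 =
    GeneratingFunctions.distEven-hasSum ℤ[p,q].ring ℤ[p,q].p ℤ[p,q].q
  , GeneratingFunctions.repEven-hasSum ℤ[p,q].ring ℤ[p,q].p ℤ[p,q].q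
  , GeneratingFunctions.rep-hasSum ℤ[p].ring ℤ[p].p
  , GeneratingFunctions.even-hasSum ℤ[p].ring ℤ[p].p
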